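{- Let $q$ be an odd prime power and $r\ge 2$ an integer. Let $F$ be a quadratic form on $\mathbb{F}_q^{r+1}$ and $\mathcal{Q}$ the quadric of $\mathrm{PG}(r,q)$ it defines, i.e. the set of points $P(x_0,\dots,x_r)$ with $F(x_0,\dots,x_r)=0$. Let $\mathcal{P}_1$ (resp. $\mathcal{P}_2$) be the set of points $P(x_0,\dots,x_r)\notin\mathcal{Q}$ for which $F(x_0,\dots,x_r)$ is a non-square (resp. a non-zero square) in $\mathbb{F}_q$. Define arcs $\mathcal{K}_1,\mathcal{K}_2$ on $\mathrm{PG}(r,q)$ by: $\mathcal{K}_1(P)=\frac{q+1}{2}$ if $P\in\mathcal{Q}$, $\mathcal{K}_1(P)=1$ if $P\in\mathcal{P}_1$, $\mathcal{K}_1(P)=0$ if $P\in\mathcal{P}_2$; and $\mathcal{K}_2(P)=\frac{q+1}{2}$ if $P\in\mathcal{Q}$, $\mathcal{K}_2(P)=0$ if $P\in\mathcal{P}_1$, $\mathcal{K}_2(P)=1$ if $P\in\mathcal{P}_2$. Then $\mathcal{K}_i$ is a $\left(\frac{q+1}{2}\bmod q\right)$-arc of $\mathrm{PG}(r,q)$ for $i=1,2$. Moreover, if $\mathcal{Q}$ is non-degenerate, then neither $\mathcal{K}_1$ nor $\mathcal{K}_2$ is lifted.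
   Context: An arc in $\mathrm{PG}(r,q)$ is a map $\mathcal{K}$ from the point set to the non-negative integers; $\mathcal{K}(S)=\sum_{Q\in S}\mathcal{K}(Q)$ for a point set $S$. $\mathcal{K}$ is a $(t\bmod q)$-arc if $\mathcal{K}(L)\equiv t\pmod q$ for every line $L$. (The classes $\mathcal{P}_1,\mathcal{P}_2$ are well defined since rescaling coordinates by $\lambda$ multiplies $F$ by $\lambda^2$.) A $(t\bmod q)$-arc $\mathcal{K}$ in $\mathrm{PG}(r,q)$ is called lifted if there exist an integer $s$ with $1\le s<r$, a projective $s$-space $\Sigma$, a projective $(r-s-1)$-space $\Gamma$ disjoint from $\Sigma$, and a $(t\bmod q)$-arc $\mathcal{K}_0$ in $\Sigma$ such that $\mathcal{K}(P)=t$ for every point $P\in\Gamma$ and $\mathcal{K}(Q)=\mathcal{K}_0(\langle\Gamma,Q\rangle\cap\Sigma)$ for every point $Q\notin\Gamma$. -}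

module Defs where

open import Level using (0ℓ)
open import Data.Nat as ℕ using (ℕ; zero; suc; _≤_; _<_; _∸_; _^_)
open import Data.Nat.Primality using (Prime)
open import Data.Nat.DivMod using (_/_)
open import Data.Integer as ℤ using (ℤ; +_)
open import Data.Integer.Divisibility using () renaming (_∣_ to _∣ℤ_)
open import Data.Fin using (Fin; zero; suc)
open import Data.Bool using (Bool; true; false; if_then_else_; _∧_; not)
open import Data.List using (List; []; _∷_; length; map; concatMap; filterᵇ)
open import Data.Bool.ListAction using (any)
open import Data.Nat.ListAction using (sum)
open import Data.List.Membership.Propositional using (_∈_)
open import Data.List.Relation.Unary.Unique.Propositional using (Unique)
open import Data.Vec.Functional using (Vector) renaming (_∷_ to _∷ᶠ_; [] to []ᶠ)
open import Data.Product using (Σ; ∃; ∃-syntax; _×_; _,_)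
open import Relation.Binary.PropositionalEquality using (_≡_; _≢_)
open import Relation.Binary.Definitions using (DecidableEquality)
open import Relation.Nullary using (¬_; does)
open import Algebra.Structures using (IsCommutativeRing)

record FiniteField : Set₁ where
  field
    Carrier  : Set
    _+_ _*_  : Carrier → Carrier → Carrier
    -_       : Carrier → Carrier
    0# 1#    : Carrier
    isCommutativeRing : IsCommutativeRing _≡_ _+_ _*_ -_ 0# 1#
    0≢1      : 0# ≢ 1#
    inverse  : ∀ x → x ≢ 0# → ∃[ y ] (x * y ≡ 1#)
    _≟_      : DecidableEquality Carrier
    elements : List Carrier
    complete : ∀ x → x ∈ elements
    unique   : Unique elements

  size : ℕ
  size = length elements

_≡_[mod_] : ℕ → ℕ → ℕ → Set
a ≡ b [mod m ] = (+ m) ∣ℤ ((+ a) ℤ.- (+ b))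

module Geometry (𝔽 : FiniteField) where
  open FiniteField 𝔽

  q : ℕ
  q = size

  V : ℕ → Set
  V n = Vector Carrier n

  ∑ : ∀ {k} → (Fin k → Carrier) → Carrier
  ∑ {zero}  f = 0#
  ∑ {suc k} f = f zero + ∑ (λ i → f (suc i))

  _≈_ : ∀ {n} → V n → V n → Set
  u ≈ w = ∀ i → u i ≡ w i

  𝟎 : ∀ {n} → V n
  𝟎 _ = 0#

  lincomb : ∀ {n k} → (Fin k → Carrier) → (Fin k → V n) → V n
  lincomb c vs i = ∑ (λ j → c j * vs j i)

  InSpan : ∀ {n k} → (Fin k → V n) → V n → Set
  InSpan vs w = ∃[ c ] (lincomb c vs ≈ w)

  LinIndep : ∀ {n k} → (Fin k → V n) → Set
  LinIndep vs = ∀ c → lincomb c vs ≈ 𝟎 → ∀ j → c j ≡ 0#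

  pair : ∀ {n} → V n → V n → Fin 2 → V n
  pair u w = u ∷ᶠ (w ∷ᶠ []ᶠ)

  -- Points of PG(n-1,q) are represented by their canonical representative:
  -- the nonzero vector whose first nonzero coordinate equals 1.
  isZero : Carrier → Bool
  isZero x = does (x ≟ 0#)

  normalized : ∀ {n} → V n → Bool
  normalized {zero}  v = false
  normalized {suc n} v = if isZero (v zero) then normalized (λ i → v (suc i))
                         else does (v zero ≟ 1#)

  IsPoint : ∀ {n} → V n → Set
  IsPoint v = normalized v ≡ true

  allVecs : ∀ n → List (V n)
  allVecs zero    = []ᶠ ∷ []
  allVecs (suc n) = concatMap (λ x → map (λ v → x ∷ᶠ v) (allVecs n)) elements

  allFinᵇ : ∀ {n} → (Fin n → Bool) → Bool
  allFinᵇ {zero}  p = true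
  allFinᵇ {suc n} p = p zero ∧ allFinᵇ (λ i → p (suc i))

  eqVecᵇ : ∀ {n} → V n → V n → Bool
  eqVecᵇ u w = allFinᵇ (λ i → does (u i ≟ w i))

  inSpan2ᵇ : ∀ {n} → V n → V n → V n → Bool
  inSpan2ᵇ u w v =
    any (λ a → any (λ b → eqVecᵇ (λ i → (a * u i) + (b * w i)) v) elements) elements

  lineSum : ∀ {n} → (V n → ℕ) → V n → V n → ℕ
  lineSum {n} K u w = sum (map K (filterᵇ (λ v → normalized v ∧ inSpan2ᵇ u w v) (allVecs n)))

  -- an arc of PG(r,q) is a map K from the points to ℕ (only its values on
  -- canonical representatives matter).
  -- (t mod q)-arc of PG(r,q): every line L has K(L) ≡ t (mod q)
  IsModArc : (r : ℕ) → ℕ → (V (suc r) → ℕ) → Set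
  IsModArc r t K = ∀ u w → LinIndep (pair u w) → lineSum K u w ≡ t [mod q ]

  IsModArcIn : ∀ {n k} → (Fin k → V n) → ℕ → (V n → ℕ) → Set
  IsModArcIn Σv t K = ∀ u w → InSpan Σv u → InSpan Σv w → LinIndep (pair u w)
                      → lineSum K u w ≡ t [mod q ]

  -- lifted (t mod q)-arcs of PG(r,q).
  -- Σ: projective s-space = span of s+1 independent vectors;
  -- Γ: projective (r-s-1)-space = span of r-s independent vectors.
  IsLifted : (r : ℕ) → ℕ → (V (suc r) → ℕ) → Set
  IsLifted r t K =
    ∃[ s ] (1 ≤ s × s < r ×
    ∃[ Σv ] (LinIndep {suc r} {suc s} Σv ×
    ∃[ Γv ] (LinIndep {suc r} {r ∸ s} Γv ×
      (∀ v → InSpan Σv v → InSpan Γv v → v ≈ 𝟎) ×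
    ∃[ K₀ ] (IsModArcIn Σv t K₀ ×
      (∀ P → IsPoint P → InSpan Γv P → K P ≡ t) ×
      (∀ Q → IsPoint Q → ¬ InSpan Γv Q →
         ∀ R → IsPoint R → InSpan Σv R → InSpan (Q ∷ᶠ Γv) R → K Q ≡ K₀ R)))))

  QuadForm : ℕ → Set
  QuadForm n = Fin n → Fin n → Carrier

  evalQ : ∀ {n} → QuadForm n → V n → Carrier
  evalQ a x = ∑ (λ i → ∑ (λ j → a i j * (x i * x j)))

  polar : ∀ {n} → QuadForm n → V n → V n → Carrier
  polar a x y = evalQ a (λ i → x i + y i) + ((- (evalQ a x)) + (- (evalQ a y)))

  -- non-degenerate quadric (q odd): the radical of the form is trivial
  NonDegenerate : ∀ {n} → QuadForm n → Set
  NonDegenerate a = ∀ x → (∀ y → polar a x y ≡ 0#) → x ≈ 𝟎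

  isSquareᵇ : Carrier → Bool
  isSquareᵇ x = any (λ y → does ((y * y) ≟ x)) elements

  half : ℕ
  half = (q ℕ.+ 1) / 2

  K₁ : ∀ {n} → QuadForm n → V n → ℕ
  K₁ a P = if isZero (evalQ a P) then half
           else (if isSquareᵇ (evalQ a P) then 0 else 1)

  K₂ : ∀ {n} → QuadForm n → V n → ℕ
  K₂ a P = if isZero (evalQ a P) then half
           else (if isSquareᵇ (evalQ a P) then 1 else 0)

{-# OPTIONS --safe #-}

-- Write κ x for the value of the arc at a point where the form takes the value x. Summing κ ∘ F
-- over all pairs of coefficients (a , b) instead of over the points of the line ⟨u , w⟩ counts
-- every point q - 1 times, so the line sum is ≡ (q + 1) / 2 (mod q) as soon as the total of κ ∘ f
-- over 𝔽² is divisible by q for every binary quadratic form f. Since κ x + κ (ε x) ≡ 1 (mod q) for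
-- every nonsquare ε, twice that total is ≡ q² if some linear bijection multiplies f by a nonsquare;
-- otherwise f depends on one variable only, up to a shear.
--
-- If the arc is lifted, its vertex Γ lies on the quadric. For P ∈ Γ and a point R of the base Σ the
-- arc is constant on the points R + tP, where the form takes the values F(R) + t · polar P R; these
-- exhaust the field unless polar P R = 0. Hence P is orthogonal to Γ and Σ, i.e. to everything.
module Submission where

open import Defs
open import Algebra.Bundles using (CommutativeRing; RawRing)
import Algebra.Properties.CommutativeSemigroup as CommutativeSemigroupProperties
import Algebra.Properties.Ring as RingProperties
import Algebra.Properties.Semiring.Mult as SemiringMult
import Algebra.Solver.Ring as RingSolver
import Algebra.Solver.Ring.AlmostCommutativeRing as ACR
import Algebra.Solver.Ring.NaturalCoefficients.Default as SemiringSolver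
open import Data.Bool using (Bool; true; false; if_then_else_; _∧_; _∨_)
open import Data.Bool.ListAction using (any)
open import Data.Fin as Fin using (Fin; _↑ˡ_; _↑ʳ_; splitAt)
open import Data.Fin.Properties as Fin using (_<?_; injective⇒≤; join-splitAt)
import Data.Integer as ℤ
import Data.Integer.Divisibility.Signed as Signed
import Data.Integer.Tactic.RingSolver as ℤSolver
open import Data.List using (List; []; _∷_; _++_; length; map; foldr; concatMap; filterᵇ; lookup; cartesianProduct; cartesianProductWith)
open import Data.List.Membership.Propositional using (_∈_; find; lose)
open import Data.List.Membership.Propositional.Properties using (∈-lookup; ∈-cartesianProduct⁺; ∈-cartesianProductWith⁺)
import Data.List.Membership.Setoid.Properties as Membershipₛ
open import Data.List.Properties using (map-++; map-cong)
open import Data.List.Relation.Unary.All as All using (All; [])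
open import Data.List.Relation.Unary.AllPairs using ([]; _∷_)
open import Data.List.Relation.Unary.Any as Any using (Any; here; there; any?)
open import Data.List.Relation.Unary.Unique.Propositional using (Unique)
open import Data.List.Relation.Unary.Unique.Propositional.Properties using (cartesianProduct⁺; cartesianProductWith⁺)
open import Data.Maybe using (Maybe; nothing; just)
open import Data.Nat as ℕ using (ℕ; zero; suc; _≤_; _∸_; _^_; z≤n; s≤s)
open import Data.Nat.Divisibility using (_∣_; divides; ∣m+n∣m⇒∣n; ∣n⇒∣m*n; m∣m*n; ∣-refl; ∣m∣n⇒∣m+n)
open import Data.Nat.DivMod using (m*n/n≡m; _/_)
open import Data.Nat.ListAction using (sum)
open import Data.Nat.ListAction.Properties using (sum-++)
open import Data.Nat.Primality using (Prime; euclidsLemma; prime⇒irreducible; prime[2])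
import Data.Nat.Properties as ℕ
open import Data.Nat.Tactic.RingSolver using (solve-∀)
open import Data.Product using (∃; _×_; _,_; proj₁; proj₂)
open import Data.Product.Properties using (≡-dec)
open import Data.Sum using (_⊎_; inj₁; inj₂; [_,_]′)
open import Data.Vec as Vec using (Vec; []; _∷_)
open import Data.Vec.Functional using (head; tail) renaming (_∷_ to _∷ᶠ_; [] to []ᶠ; _++_ to _++ᶠ_)
open import Data.Vec.Functional.Properties using (lookup-++ˡ; lookup-++ʳ)
import Data.Vec.Properties as Vec
open import Function using (_∘_; id)
open import Function.Bundles using (mk⇔)
open import Function.Definitions using (Injective)
open import Level using (0ℓ)
open import Relation.Binary.Definitions using (DecidableEquality; tri<; tri≈; tri>)
open import Relation.Binary.PropositionalEquality
open import Relation.Nullary using (¬_; Dec; yes; no; does; contradiction; ¬?; _×-dec_)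
open import Relation.Nullary.Decidable using (decidable-stable; map′; dec-true; dec-false; does-⇔)
open import Relation.Unary using (Pred; Decidable)

open CommutativeSemigroupProperties ℕ.+-commutativeSemigroup using (interchange)

-- The value (q + 1) / 2 on the quadric has two tasks. It inverts 2 modulo q, so that a zero of the
-- form, counted twice, gives q + 1 and obeys the same congruence κ x + κ (ε x) ≡ 1 as the other
-- values. It is also the term of the zero coefficient pair, the only pair that represents no point,
-- and so it becomes the residue of every line sum. Working with all pairs removes the distinction
-- between external, tangent and secant lines.
--
-- The similitude of a s² + b t² is multiplication by x + y δ with δ² = - a b. It acts on a s + t δ,
-- whose norm is a (a s² + b t²), and scales norms by x² + a b y². What has to be found is therefore
-- a nonsquare among these norms. This, the existence of nonsquares and the fact that they form a
-- single class all come from one principle: an injective map of a finite set into itself is onto.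
-- The position in the enumeration of the field serves as an order that picks one of y and - y.

𝟙 : Bool → ℕ
𝟙 true  = 1
𝟙 false = 0

𝟙-∧ : ∀ x y → 𝟙 (x ∧ y) ≡ 𝟙 x ℕ.* 𝟙 y
𝟙-∧ true  y = sym (ℕ.*-identityˡ (𝟙 y))
𝟙-∧ false y = refl

-- Finite sums of natural numbers over lists.

module _ {A : Set} where

  Sum : List A → (A → ℕ) → ℕ
  Sum xs f = sum (map f xs)

  Sum-cong : ∀ xs {f g : A → ℕ} → (∀ x → f x ≡ g x) → Sum xs f ≡ Sum xs g
  Sum-cong []       f≗g = refl
  Sum-cong (x ∷ xs) f≗g = cong₂ ℕ._+_ (f≗g x) (Sum-cong xs f≗g)

  Sum-+ : ∀ xs (f g : A → ℕ) → Sum xs (λ x → f x ℕ.+ g x) ≡ Sum xs f ℕ.+ Sum xs g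
  Sum-+ []       f g = refl
  Sum-+ (x ∷ xs) f g = begin
    (f x ℕ.+ g x) ℕ.+ Sum xs (λ x → f x ℕ.+ g x) ≡⟨ cong (f x ℕ.+ g x ℕ.+_) (Sum-+ xs f g) ⟩
    (f x ℕ.+ g x) ℕ.+ (Sum xs f ℕ.+ Sum xs g)    ≡⟨ interchange (f x) (g x) (Sum xs f) (Sum xs g) ⟩
    (f x ℕ.+ Sum xs f) ℕ.+ (g x ℕ.+ Sum xs g)    ∎
    where open ≡-Reasoning

  Sum-*ˡ : ∀ xs c (f : A → ℕ) → Sum xs (λ x → c ℕ.* f x) ≡ c ℕ.* Sum xs f
  Sum-*ˡ []       c f = sym (ℕ.*-zeroʳ c)
  Sum-*ˡ (x ∷ xs) c f =
    trans (cong (c ℕ.* f x ℕ.+_) (Sum-*ˡ xs c f)) (sym (ℕ.*-distribˡ-+ c (f x) (Sum xs f)))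

  Sum-*ʳ : ∀ xs (f : A → ℕ) c → Sum xs (λ x → f x ℕ.* c) ≡ Sum xs f ℕ.* c
  Sum-*ʳ xs f c = trans (Sum-cong xs (λ x → ℕ.*-comm (f x) c))
                        (trans (Sum-*ˡ xs c f) (ℕ.*-comm c (Sum xs f)))

  Sum-const : ∀ xs c → Sum xs (λ (_ : A) → c) ≡ length xs ℕ.* c
  Sum-const []       c = refl
  Sum-const (x ∷ xs) c = cong (c ℕ.+_) (Sum-const xs c)

  Sum-zero : ∀ xs → Sum xs (λ (_ : A) → 0) ≡ 0
  Sum-zero xs = trans (Sum-const xs 0) (ℕ.*-zeroʳ (length xs))

  Sum-++ : ∀ xs ys (f : A → ℕ) → Sum (xs ++ ys) f ≡ Sum xs f ℕ.+ Sum ys f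
  Sum-++ xs ys f = trans (cong sum (map-++ f xs ys)) (sum-++ (map f xs) (map f ys))

  Sum-filterᵇ : ∀ p xs (f : A → ℕ) → Sum (filterᵇ p xs) f ≡ Sum xs (λ x → 𝟙 (p x) ℕ.* f x)
  Sum-filterᵇ p []       f = refl
  Sum-filterᵇ p (x ∷ xs) f with p x
  ... | true  = cong₂ ℕ._+_ (sym (ℕ.*-identityˡ (f x))) (Sum-filterᵇ p xs f)
  ... | false = Sum-filterᵇ p xs f

module _ {A B : Set} where

  Sum-swap : ∀ xs ys (f : A → B → ℕ) →
             Sum xs (λ x → Sum ys (f x)) ≡ Sum ys (λ y → Sum xs (λ x → f x y))
  Sum-swap []       ys f = sym (Sum-zero ys)
  Sum-swap (x ∷ xs) ys f =
    trans (cong (Sum ys (f x) ℕ.+_) (Sum-swap xs ys f)) (sym (Sum-+ ys (f x) _))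

  Sum-map : ∀ (h : A → B) xs (f : B → ℕ) → Sum (map h xs) f ≡ Sum xs (f ∘ h)
  Sum-map h []       f = refl
  Sum-map h (x ∷ xs) f = cong (f (h x) ℕ.+_) (Sum-map h xs f)

  Sum-concatMap : ∀ (h : A → List B) xs (f : B → ℕ) →
                  Sum (concatMap h xs) f ≡ Sum xs (λ x → Sum (h x) f)
  Sum-concatMap h []       f = refl
  Sum-concatMap h (x ∷ xs) f =
    trans (Sum-++ (h x) (concatMap h xs) f) (cong (Sum (h x) f ℕ.+_) (Sum-concatMap h xs f))

module _ {A B : Set} where

  Sum-cartesianProduct : ∀ xs ys (f : A × B → ℕ) →
    Sum (cartesianProduct xs ys) f ≡ Sum xs (λ x → Sum ys (λ y → f (x , y)))
  Sum-cartesianProduct []       ys f = refl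
  Sum-cartesianProduct (x ∷ xs) ys f =
    trans (Sum-++ (map (x ,_) ys) _ f)
          (cong₂ ℕ._+_ (Sum-map (x ,_) ys f) (Sum-cartesianProduct xs ys f))

Unique⇒lookup-injective : ∀ {A : Set} {xs : List A} → Unique xs → Injective _≡_ _≡_ (lookup xs)
Unique⇒lookup-injective (x∉xs ∷ xs!) {Fin.zero}  {Fin.zero}  eq = refl
Unique⇒lookup-injective (x∉xs ∷ xs!) {Fin.zero}  {Fin.suc j} eq =
  contradiction eq (All.lookup x∉xs (∈-lookup j))
Unique⇒lookup-injective (x∉xs ∷ xs!) {Fin.suc i} {Fin.zero}  eq =
  contradiction (sym eq) (All.lookup x∉xs (∈-lookup i))
Unique⇒lookup-injective (x∉xs ∷ xs!) {Fin.suc i} {Fin.suc j} eq =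
  cong Fin.suc (Unique⇒lookup-injective xs! eq)

-- Pigeonhole and reindexing on a finite enumerated type.

module Finite {A : Set} (_≟_ : DecidableEquality A)
              (xs : List A) (complete : ∀ x → x ∈ xs) (xs! : Unique xs) where

  search : ∀ {p} {P : Pred A p} → Decidable P → Dec (∃ P)
  search P? = map′ (λ p → let x , _ , px = find p in x , px) (λ (x , px) → lose (complete x) px)
                   (any? P? xs)

  opaque
    -- Besides being an injection for counting, this is a linear order on a type that has no natural
    -- one. Only its injectivity matters, hence `opaque`.
    rank : A → Fin (length xs)
    rank x = Any.index (complete x)

    rank-injective : Injective _≡_ _≡_ rank
    rank-injective {x} {y} = Membershipₛ.index-injective (setoid A) (complete x) (complete y)

  -- Pigeonhole: a missed value `z`, put in front of the images of all elements, would inject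
  -- `suc (length xs)` indices into `length xs` of them.
  injective⇒surjective : ∀ {f : A → A} → Injective _≡_ _≡_ f → ∀ z → ∃ λ x → f x ≡ z
  injective⇒surjective {f} f-inj z with search (λ x → f x ≟ z)
  ... | yes p     = p
  ... | no missed = contradiction (injective⇒≤ g-injective) ℕ.1+n≰n
    where
    g : Fin (suc (length xs)) → Fin (length xs)
    g Fin.zero    = rank z
    g (Fin.suc i) = rank (f (lookup xs i))

    g-injective : Injective _≡_ _≡_ g
    g-injective {Fin.zero}  {Fin.zero}  eq = refl
    g-injective {Fin.zero}  {Fin.suc j} eq = contradiction (_ , sym (rank-injective eq)) missed
    g-injective {Fin.suc i} {Fin.zero}  eq = contradiction (_ , rank-injective eq) missed
    g-injective {Fin.suc i} {Fin.suc j} eq =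
      cong Fin.suc (Unique⇒lookup-injective xs! (f-inj (rank-injective eq)))

  private
    Sum-absent : ∀ {ys c} → All (c ≢_) ys → (g : A → ℕ) → Sum ys (λ x → 𝟙 (does (x ≟ c)) ℕ.* g x) ≡ 0
    Sum-absent All.[]          g = refl
    Sum-absent {y ∷ ys} {c} (c≢y All.∷ c∉ys) g
      rewrite dec-false (y ≟ c) (c≢y ∘ sym) = Sum-absent c∉ys g

    Sum-single : ∀ {ys c} → Unique ys → c ∈ ys → (g : A → ℕ) →
                 Sum ys (λ x → 𝟙 (does (x ≟ c)) ℕ.* g x) ≡ g c
    Sum-single {y ∷ ys} {c} (c∉ys ∷ ys!) (here refl) g
      rewrite dec-true (c ≟ c) refl | Sum-absent c∉ys g =
        trans (ℕ.+-identityʳ (g c ℕ.+ 0)) (ℕ.+-identityʳ (g c))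
    Sum-single {y ∷ ys} {c} (y∉ys ∷ ys!) (there c∈ys) g
      rewrite dec-false (y ≟ c) (All.lookup y∉ys c∈ys) = Sum-single ys! c∈ys g

  Sum-δ : ∀ c (g : A → ℕ) → Sum xs (λ x → 𝟙 (does (x ≟ c)) ℕ.* g x) ≡ g c
  Sum-δ c = Sum-single xs! (complete c)

  Sum-δ₁ : ∀ c → Sum xs (λ x → 𝟙 (does (x ≟ c))) ≡ 1
  Sum-δ₁ c = trans (Sum-cong xs (λ x → sym (ℕ.*-identityʳ _))) (Sum-δ c (λ _ → 1))

  -- Double counting of the pairs with y = f x replaces any handling of list permutations: summed
  -- over y first they give the left side, summed over x first the right side, since each fibre of
  -- `f` is a single element.
  Sum-reindex : ∀ {f : A → A} → Injective _≡_ _≡_ f → (g : A → ℕ) → Sum xs (g ∘ f) ≡ Sum xs g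
  Sum-reindex {f} f-inj g = begin
    Sum xs (g ∘ f)
      ≡⟨ Sum-cong xs (λ x → Sum-δ (f x) g) ⟨
    Sum xs (λ x → Sum xs (λ y → 𝟙 (does (y ≟ f x)) ℕ.* g y))
      ≡⟨ Sum-swap xs xs _ ⟩
    Sum xs (λ y → Sum xs (λ x → 𝟙 (does (y ≟ f x)) ℕ.* g y))
      ≡⟨ Sum-cong xs (λ y → trans (Sum-*ʳ xs _ (g y)) (trans (cong (ℕ._* g y) (fibre y)) (ℕ.*-identityˡ (g y)))) ⟩
    Sum xs g ∎
    where
    open ≡-Reasoning
    fibre : ∀ y → Sum xs (λ x → 𝟙 (does (y ≟ f x))) ≡ 1
    fibre y with x₀ , refl ← injective⇒surjective f-inj y =
      trans (Sum-cong xs (λ x → cong 𝟙 (does-⇔ (mk⇔ (sym ∘ f-inj) (cong f ∘ sym)) (f x₀ ≟ f x) (x ≟ x₀))))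
            (Sum-δ₁ x₀)

-- A ring solver for an abstract finite field.

-- The coefficient (m , n) stands for m - n, so that the solver can cancel
-- opposite terms although nothing computes in an abstract field.
module FieldSolver (𝔽 : FiniteField) where
  commutativeRing : CommutativeRing 0ℓ 0ℓ
  commutativeRing = record { isCommutativeRing = FiniteField.isCommutativeRing 𝔽 }
  open CommutativeRing commutativeRing hiding (sym; trans; refl)
  open RingProperties ring
  open SemiringMult semiring using (×-homo-+; ×1-homo-*) renaming (_×_ to _·_)

  Diff : Set
  Diff = ℕ × ℕ

  -- One entry of the result is zero, so equal differences get the same representative and `coeff≟`
  -- may compare pairs literally.
  cancel : ℕ → ℕ → Diff
  cancel (suc m) (suc n) = cancel m n
  cancel m       n       = m , n

  coeffs : RawRing 0ℓ 0ℓ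
  coeffs = record
    { Carrier = Diff
    ; _≈_ = _≡_
    ; _+_ = λ (m , n) (m′ , n′) → cancel (m ℕ.+ m′) (n ℕ.+ n′)
    ; _*_ = λ (m , n) (m′ , n′) → cancel (m ℕ.* m′ ℕ.+ n ℕ.* n′) (m ℕ.* n′ ℕ.+ n ℕ.* m′)
    ; -_ = λ (m , n) → n , m
    ; 0# = 0 , 0
    ; 1# = 1 , 0
    }

  ⟦_⟧ : Diff → Carrier
  ⟦ m , n ⟧ = (m · 1#) - (n · 1#)

  open ≡-Reasoning
  -- The morphism has to be established before the ring solver exists. The semiring solver suffices
  -- once negated terms are passed to it as atoms.
  private module S = SemiringSolver commutativeSemiring
  open S using () renaming (solve to solveₛ; _:=_ to _:=ₛ_; _:+_ to _:+ₛ_; _:*_ to _:*ₛ_)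

  cancel-homo : ∀ m n → ⟦ cancel m n ⟧ ≡ ⟦ m , n ⟧
  cancel-homo zero    zero    = refl
  cancel-homo zero    (suc n) = refl
  cancel-homo (suc m) zero    = refl
  cancel-homo (suc m) (suc n) = begin
    ⟦ cancel m n ⟧    ≡⟨ cancel-homo m n ⟩
    M - N             ≡⟨ +-identityˡ (M - N) ⟨
    0# + (M - N)      ≡⟨ cong (_+ (M - N)) (-‿inverseʳ 1#) ⟨
    (1# - 1#) + (M - N)
      ≡⟨ solveₛ 4 (λ a b c d → (a :+ₛ b) :+ₛ (c :+ₛ d) :=ₛ (a :+ₛ c) :+ₛ (b :+ₛ d)) refl 1# (- 1#) M (- N) ⟩
    (1# + M) + (- 1# - N)
      ≡⟨ cong ((1# + M) +_) (-‿+-comm 1# N) ⟩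
    (1# + M) - (1# + N) ∎
    where
      M = m · 1#
      N = n · 1#

  +-homo : ∀ x y → ⟦ RawRing._+_ coeffs x y ⟧ ≡ ⟦ x ⟧ + ⟦ y ⟧
  +-homo (m , n) (m′ , n′) = begin
    ⟦ cancel (m ℕ.+ m′) (n ℕ.+ n′) ⟧
      ≡⟨ cancel-homo (m ℕ.+ m′) (n ℕ.+ n′) ⟩
    ((m ℕ.+ m′) · 1#) - ((n ℕ.+ n′) · 1#)
      ≡⟨ cong₂ _-_ (×-homo-+ 1# m m′) (×-homo-+ 1# n n′) ⟩
    (m · 1# + m′ · 1#) - (n · 1# + n′ · 1#)
      ≡⟨ cong ((m · 1# + m′ · 1#) +_) (sym (-‿+-comm _ _)) ⟩
    (m · 1# + m′ · 1#) + (- (n · 1#) + - (n′ · 1#))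
      ≡⟨ solveₛ 4 (λ a b c d → (a :+ₛ b) :+ₛ (c :+ₛ d) :=ₛ (a :+ₛ c) :+ₛ (b :+ₛ d)) refl _ _ _ _ ⟩
    ⟦ m , n ⟧ + ⟦ m′ , n′ ⟧ ∎

  *-homo : ∀ x y → ⟦ RawRing._*_ coeffs x y ⟧ ≡ ⟦ x ⟧ * ⟦ y ⟧
  *-homo (m , n) (m′ , n′) = begin
    ⟦ cancel (m ℕ.* m′ ℕ.+ n ℕ.* n′) (m ℕ.* n′ ℕ.+ n ℕ.* m′) ⟧
      ≡⟨ cancel-homo (m ℕ.* m′ ℕ.+ n ℕ.* n′) (m ℕ.* n′ ℕ.+ n ℕ.* m′) ⟩
    ((m ℕ.* m′ ℕ.+ n ℕ.* n′) · 1#) - ((m ℕ.* n′ ℕ.+ n ℕ.* m′) · 1#)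
      ≡⟨ cong₂ _-_ (homo m m′ n n′) (homo m n′ n m′) ⟩
    (M * M′ + N * N′) - (M * N′ + N * M′)
      ≡⟨ cong₂ _+_ (cong (M * M′ +_) (sym (trans (sym (-‿distribˡ-* N (- N′)))
           (trans (cong -_ (sym (-‿distribʳ-* N N′))) (-‿involutive _)))))
           (trans (sym (-‿+-comm _ _)) (cong₂ _+_ (-‿distribʳ-* M N′) (-‿distribˡ-* N M′))) ⟩
    (M * M′ + (- N) * (- N′)) + (M * (- N′) + (- N) * M′)
      ≡⟨ solveₛ 4 (λ a b c d → (a :*ₛ c :+ₛ b :*ₛ d) :+ₛ (a :*ₛ d :+ₛ b :*ₛ c) :=ₛ (a :+ₛ b) :*ₛ (c :+ₛ d)) refl M (- N) M′ (- N′) ⟩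
    (M - N) * (M′ - N′) ∎
    where
      M = m · 1#
      N = n · 1#
      M′ = m′ · 1#
      N′ = n′ · 1#
      homo : ∀ a b c d → (a ℕ.* b ℕ.+ c ℕ.* d) · 1# ≡ (a · 1#) * (b · 1#) + (c · 1#) * (d · 1#)
      homo a b c d = trans (×-homo-+ 1# (a ℕ.* b) (c ℕ.* d)) (cong₂ _+_ (×1-homo-* a b) (×1-homo-* c d))

  morphism : coeffs ACR.-Raw-AlmostCommutative⟶ ACR.fromCommutativeRing commutativeRing
  morphism = record
    { ⟦_⟧ = ⟦_⟧
    ; +-homo = +-homo
    ; *-homo = *-homo
    ; -‿homo = λ (m , n) → trans (+-comm _ _)
        (trans (cong (- (m · 1#) +_) (sym (-‿involutive _))) (-‿+-comm _ _))
    ; 0-homo = -‿inverseʳ 0#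
    ; 1-homo = trans (cong₂ _+_ (+-identityʳ 1#) -0#≈0#) (+-identityʳ 1#)
    }

  coeff≟ : ∀ x y → Maybe (⟦ x ⟧ ≡ ⟦ y ⟧)
  coeff≟ x y with ≡-dec ℕ._≟_ ℕ._≟_ x y
  ... | no _     = nothing
  ... | yes refl = just refl

  open RingSolver coeffs (ACR.fromCommutativeRing commutativeRing) morphism coeff≟ public
    using (Polynomial; solve; _:=_; _:+_; _:*_; :-_; _:^_; con)

  -- A zeroth power evaluates to `1#` itself, whereas `con (1 , 0)` evaluates to the unreduced
  -- difference `(1# + 0#) - 0#` and would not match goals that mention `1#`.
  :1 : ∀ {n} → Polynomial n
  :1 = con (1 , 0) :^ 0

-- Cancellation and squares in a finite field.

module FieldTheory (𝔽 : FiniteField) where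
  open FiniteField 𝔽 public using (Carrier; size; elements; complete; unique; inverse; 0≢1; _≟_)
  open FieldSolver 𝔽 public using (commutativeRing; solve; _:=_; _:+_; _:*_; :-_; :1)
  open CommutativeRing commutativeRing public
    using (_+_; _*_; -_; _-_; 0#; 1#; +-assoc; +-comm; +-identityˡ; +-identityʳ; -‿inverseʳ; -‿inverseˡ;
           *-assoc; *-comm; *-identityˡ; *-identityʳ; zeroˡ; zeroʳ)
  open RingProperties (CommutativeRing.ring commutativeRing) public using (-‿involutive; -0#≈0#)
  open Finite _≟_ elements complete unique public
  open ≡-Reasoning

  *-cancelˡ : ∀ {x y z} → x ≢ 0# → x * y ≡ x * z → y ≡ z
  *-cancelˡ {x} {y} {z} x≢0 xy≡xz with x⁻¹ , xx⁻¹≡1 ← inverse x x≢0 = begin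
    y             ≡⟨ unit y ⟨
    x⁻¹ * (x * y) ≡⟨ cong (x⁻¹ *_) xy≡xz ⟩
    x⁻¹ * (x * z) ≡⟨ unit z ⟩
    z             ∎
    where
    unit : ∀ y → x⁻¹ * (x * y) ≡ y
    unit y = trans (solve 3 (λ i x y → i :* (x :* y) := (x :* i) :* y) refl x⁻¹ x y)
                   (trans (cong (_* y) xx⁻¹≡1) (*-identityˡ y))

  x*y≡0⇒y≡0 : ∀ {x y} → x ≢ 0# → x * y ≡ 0# → y ≡ 0#
  x*y≡0⇒y≡0 {x} x≢0 xy≡0 = *-cancelˡ x≢0 (trans xy≡0 (sym (zeroʳ x)))

  *-nonzero : ∀ {x y} → x ≢ 0# → y ≢ 0# → x * y ≢ 0#
  *-nonzero x≢0 y≢0 xy≡0 = y≢0 (x*y≡0⇒y≡0 x≢0 xy≡0)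

  x-y≡0⇒x≡y : ∀ {x y} → x - y ≡ 0# → x ≡ y
  x-y≡0⇒x≡y {x} {y} x-y≡0 = begin
    x           ≡⟨ solve 2 (λ x y → x := (x :+ :- y) :+ y) refl x y ⟩
    (x - y) + y ≡⟨ cong (_+ y) x-y≡0 ⟩
    0# + y      ≡⟨ +-identityˡ y ⟩
    y           ∎

  +-cancelʳ : ∀ z {x y} → x + z ≡ y + z → x ≡ y
  +-cancelʳ z {x} {y} eq = begin
    x           ≡⟨ solve 2 (λ x z → x := (x :+ z) :+ :- z) refl x z ⟩
    (x + z) - z ≡⟨ cong (_- z) eq ⟩
    (y + z) - z ≡⟨ solve 2 (λ y z → (y :+ z) :+ :- z := y) refl y z ⟩
    y           ∎

  x²≡0⇒x≡0 : ∀ {x} → x * x ≡ 0# → x ≡ 0#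
  x²≡0⇒x≡0 {x} x²≡0 with x ≟ 0#
  ... | yes x≡0 = x≡0
  ... | no  x≢0 = x*y≡0⇒y≡0 x≢0 x²≡0

  x²≡y²⇒x≡±y : ∀ {x y} → x * x ≡ y * y → x ≡ y ⊎ x ≡ - y
  x²≡y²⇒x≡±y {x} {y} x²≡y² with (x - y) ≟ 0#
  ... | yes x-y≡0 = inj₁ (x-y≡0⇒x≡y x-y≡0)
  ... | no  x-y≢0 = inj₂ (x-y≡0⇒x≡y (trans (cong (x +_) (-‿involutive y)) (x*y≡0⇒y≡0 x-y≢0 (begin
    (x - y) * (x + y) ≡⟨ solve 2 (λ x y → (x :+ :- y) :* (x :+ y) := x :* x :+ :- (y :* y)) refl x y ⟩
    x * x - y * y     ≡⟨ cong (_- y * y) x²≡y² ⟩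
    y * y - y * y     ≡⟨ -‿inverseʳ (y * y) ⟩
    0#                ∎))))

  Square : Carrier → Set
  Square x = ∃ λ y → y * y ≡ x

  square? : ∀ x → Dec (Square x)
  square? x = search (λ y → (y * y) ≟ x)

  0-square : Square 0#
  0-square = 0# , zeroʳ 0#

  nonsquare⇒≢0 : ∀ {x} → ¬ Square x → x ≢ 0#
  nonsquare⇒≢0 ¬sq refl = ¬sq 0-square

  square-quotient : ∀ {c x} → c ≢ 0# → Square ((c * c) * x) → Square x
  square-quotient {c} {x} c≢0 (y , y²≡c²x) with c⁻¹ , cc⁻¹≡1 ← inverse c c≢0 = (c⁻¹ * y) , (begin
    (c⁻¹ * y) * (c⁻¹ * y)
      ≡⟨ solve 2 (λ i y → (i :* y) :* (i :* y) := (i :* i) :* (y :* y)) refl c⁻¹ y ⟩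
    (c⁻¹ * c⁻¹) * (y * y)
      ≡⟨ cong ((c⁻¹ * c⁻¹) *_) y²≡c²x ⟩
    (c⁻¹ * c⁻¹) * ((c * c) * x)
      ≡⟨ solve 3 (λ i c x → (i :* i) :* ((c :* c) :* x) := (c :* i) :* ((c :* i) :* x)) refl c⁻¹ c x ⟩
    (c * c⁻¹) * ((c * c⁻¹) * x)
      ≡⟨ cong (λ u → u * (u * x)) cc⁻¹≡1 ⟩
    1# * (1# * x)
      ≡⟨ trans (*-identityˡ _) (*-identityˡ x) ⟩
    x ∎)

  square-scale : ∀ c {x} → Square x → Square ((c * c) * x)
  square-scale c (y , refl) =
    (c * y) , solve 2 (λ c y → (c :* y) :* (c :* y) := (c :* c) :* (y :* y)) refl c y

-- Nonsquares in a field of odd order.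

module OddField (𝔽 : FiniteField) (m : ℕ) (odd : FiniteField.size 𝔽 ≡ suc (m ℕ.+ m)) where
  open FieldTheory 𝔽
  open ≡-Reasoning

  -- If 1 + 1 = 0, then x ↦ x + 1 is an involution without fixed points, and counting
  -- the x that precede x + 1 in the enumeration gives half of the field.
  1+1≢0 : 1# + 1# ≢ 0#
  1+1≢0 1+1≡0 = ℕ.even≢odd s m (begin
    2 ℕ.* s
      ≡⟨ cong (s ℕ.+_) (ℕ.+-identityʳ s) ⟩
    s ℕ.+ s
      ≡⟨ cong (s ℕ.+_) (Sum-reindex (+-cancelʳ 1#) below) ⟨
    s ℕ.+ Sum elements (λ x → below (x + 1#))
      ≡⟨ Sum-+ elements below _ ⟨
    Sum elements (λ x → below x ℕ.+ below (x + 1#))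
      ≡⟨ Sum-cong elements one ⟩
    Sum elements (λ _ → 1)
      ≡⟨ trans (Sum-const elements 1) (ℕ.*-identityʳ size) ⟩
    size
      ≡⟨ trans odd (cong (λ z → suc (m ℕ.+ z)) (sym (ℕ.+-identityʳ m))) ⟩
    suc (2 ℕ.* m) ∎)
    where
    below : Carrier → ℕ
    below x = 𝟙 (does (rank x <? rank (x + 1#)))

    s : ℕ
    s = Sum elements below

    involutive : ∀ x → (x + 1#) + 1# ≡ x
    involutive x = trans (+-assoc x 1# 1#) (trans (cong (x +_) 1+1≡0) (+-identityʳ x))

    one : ∀ x → below x ℕ.+ below (x + 1#) ≡ 1
    one x rewrite involutive x with Fin.<-cmp (rank x) (rank (x + 1#))
    ... | tri< x<y _ y≮x rewrite dec-true (rank x <? rank (x + 1#)) x<y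
                               | dec-false (rank (x + 1#) <? rank x) y≮x = refl
    ... | tri> x≮y _ y<x rewrite dec-false (rank x <? rank (x + 1#)) x≮y
                               | dec-true (rank (x + 1#) <? rank x) y<x = refl
    ... | tri≈ _ x≈y _ = contradiction (begin
      0#             ≡⟨ -‿inverseˡ x ⟨
      (- x) + x      ≡⟨ cong ((- x) +_) (rank-injective x≈y) ⟩
      (- x) + (x + 1#) ≡⟨ +-assoc (- x) x 1# ⟨
      ((- x) + x) + 1# ≡⟨ cong (_+ 1#) (-‿inverseˡ x) ⟩
      0# + 1#        ≡⟨ +-identityˡ 1# ⟩
      1#             ∎) 0≢1

  -- If everything were a square, a choice of roots would be injective, because squaring undoes it,
  -- and hence onto. Then 1 and -1 would both be chosen roots, yet of the same element 1, so 1 = -1.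
  nonsquare : ∃ λ ε → ¬ Square ε
  nonsquare with search (λ x → ¬? (square? x))
  ... | yes p = p
  ... | no all-squares = contradiction
    (begin
      1# + 1#    ≡⟨ cong (1# +_) 1≡-1 ⟩
      1# + - 1#  ≡⟨ -‿inverseʳ 1# ⟩
      0#         ∎) 1+1≢0
    where
    sqrt : ∀ x → Square x
    sqrt x = decidable-stable (square? x) (λ ¬sq → all-squares (x , ¬sq))

    √ : Carrier → Carrier
    √ x = proj₁ (sqrt x)

    √-injective : Injective _≡_ _≡_ √
    √-injective {x} {y} √x≡√y =
      trans (sym (proj₂ (sqrt x))) (trans (cong (λ z → z * z) √x≡√y) (proj₂ (sqrt y)))

    root : ∀ {x y} → √ x ≡ y → x ≡ y * y
    root {x} refl = sym (proj₂ (sqrt x))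

    1≡-1 : 1# ≡ - 1#
    1≡-1 with a , √a≡1 ← injective⇒surjective √-injective 1#
            | b , √b≡-1 ← injective⇒surjective √-injective (- 1#) = begin
      1#   ≡⟨ √a≡1 ⟨
      √ a  ≡⟨ cong √ (trans (root √a≡1) (trans
                 (solve 1 (λ o → o :* o := (:- o) :* (:- o)) refl 1#) (sym (root √b≡-1)))) ⟩
      √ b  ≡⟨ √b≡-1 ⟩
      - 1# ∎

  -- The enumeration chooses one element y out of each pair {y , - y}. Sending it to y² and the
  -- other one to ε y² is injective, hence surjective: nonsquares are ε times a square.
  nonsquare-class : ∀ {ε x} → ¬ Square ε → ¬ Square x → ∃ λ y → ε * (y * y) ≡ x
  nonsquare-class {ε} {x} ε-nonsq x-nonsq =
    preimage (injective⇒surjective ψ-injective x)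
    where
    choose : ∀ y → Dec (rank y Fin.< rank (- y)) → Carrier
    choose y (yes _) = y * y
    choose y (no  _) = ε * (y * y)

    ψ : Carrier → Carrier
    ψ y = choose y (rank y <? rank (- y))

    -- The strict order forces y ≠ 0, so 0 belongs to the `ε` branch alone; this excludes z = 0. For
    -- z ≠ 0, dividing by z² would make `ε` a square.
    mixed : ∀ {y z} → rank y Fin.< rank (- y) → y * y ≢ ε * (z * z)
    mixed {y} {z} y<-y y²≡εz² with z ≟ 0#
    ... | no z≢0 = ε-nonsq (square-quotient z≢0 (y , trans y²≡εz² (*-comm ε (z * z))))
    ... | yes refl = Fin.<-irrefl (cong rank y≡-y) y<-y
      where
      y≡0 : y ≡ 0#
      y≡0 = x²≡0⇒x≡0 (trans y²≡εz² (trans (cong (ε *_) (zeroʳ 0#)) (zeroʳ ε)))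
      y≡-y : y ≡ - y
      y≡-y = trans y≡0 (trans (sym -0#≈0#) (cong -_ (sym y≡0)))

    both-precede : ∀ {y z} → rank y Fin.< rank (- y) → rank z Fin.< rank (- z) → y ≡ - z → y ≡ z
    both-precede {y} {z} y<-y z<-z refl =
      contradiction (subst (λ w → rank (- z) Fin.< rank w) (-‿involutive z) y<-y) (ℕ.<-asym z<-z)

    neither-precedes : ∀ {y z} → ¬ (rank y Fin.< rank (- y)) → ¬ (rank z Fin.< rank (- z)) → y ≡ - z → y ≡ z
    neither-precedes {y} {z} y≮-y z≮-z refl = rank-injective (Fin.toℕ-injective (ℕ.≤-antisym (ℕ.≮⇒≥ z≮-z)
      (ℕ.≮⇒≥ (subst (λ w → ¬ (rank (- z) Fin.< rank w)) (-‿involutive z) y≮-y))))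

    choose-injective : ∀ y z y? z? → choose y y? ≡ choose z z? → y ≡ z
    choose-injective y z (yes y<-y) (no _)     eq = contradiction eq (mixed y<-y)
    choose-injective y z (no _)     (yes z<-z) eq = contradiction (sym eq) (mixed z<-z)
    choose-injective y z (yes y<-y) (yes z<-z) eq = [ id , both-precede y<-y z<-z ]′ (x²≡y²⇒x≡±y eq)
    choose-injective y z (no y≮-y) (no z≮-z) eq =
      [ id , neither-precedes y≮-y z≮-z ]′ (x²≡y²⇒x≡±y (*-cancelˡ (nonsquare⇒≢0 ε-nonsq) eq))

    ψ-injective : Injective _≡_ _≡_ ψ
    ψ-injective {y} {z} = choose-injective y z (rank y <? rank (- y)) (rank z <? rank (- z))

    preimage : (∃ λ y → ψ y ≡ x) → ∃ λ y → ε * (y * y) ≡ x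
    preimage (y , ψy≡x) = decide (rank y <? rank (- y)) ψy≡x
      where
      decide : ∀ y? → choose y y? ≡ x → ∃ λ y → ε * (y * y) ≡ x
      decide (yes _) y²≡x  = contradiction (y , y²≡x) x-nonsq
      decide (no _)  εy²≡x = y , εy²≡x

  nonsquare*nonsquare : ∀ {ε x} → ¬ Square ε → ¬ Square x → Square (ε * x)
  nonsquare*nonsquare {ε} ε-nonsq x-nonsq with y , refl ← nonsquare-class ε-nonsq x-nonsq =
    (ε * y) , solve 2 (λ e y → (e :* y) :* (e :* y) := e :* (e :* (y :* y))) refl ε y

  nonsquare*square : ∀ {ε x} → ¬ Square ε → x ≢ 0# → Square x → ¬ Square (ε * x)
  nonsquare*square {ε} ε-nonsq y²≢0 (y , refl) sq =
    ε-nonsq (square-quotient (λ { refl → y²≢0 (zeroʳ 0#) })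
      (subst Square (*-comm ε (y * y)) sq))

  -- If the squares were closed under addition, then adding 1 would permute them, -1 would be a
  -- square, and so would every z = ((z + 1) / 2)² - ((z - 1) / 2)².
  nonsquare-sum-of-squares : ∃ λ ((x , y) : Carrier × Carrier) → ¬ Square (x * x + y * y)
  nonsquare-sum-of-squares
    with search (λ x → nonsq? x)
    where
    nonsq? : ∀ x → Dec (∃ λ y → ¬ Square (x * x + y * y))
    nonsq? x = search (λ y → ¬? (square? (x * x + y * y)))
  ... | yes (x , y , p) = (x , y) , p
  ... | no none = contradiction (λ z → all-squares z) (λ all → proj₂ nonsquare (all _))
    where
    closed : ∀ x y → Square (x * x + y * y)
    closed x y = decidable-stable (square? _) (λ ¬sq → none (x , y , ¬sq))

    square+1 : ∀ {x} → Square x → Square (x + 1#)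
    square+1 (y , refl) = subst (λ o → Square (y * y + o)) (*-identityˡ 1#) (closed y 1#)

    shift : Carrier → Carrier
    shift x with square? x
    ... | yes _ = x + 1#
    ... | no  _ = x

    shift-injective : Injective _≡_ _≡_ shift
    shift-injective {x} {y} eq with square? x | square? y
    ... | yes _  | yes _   = +-cancelʳ 1# eq
    ... | yes sq | no ¬sq  = contradiction (subst Square eq (square+1 sq)) ¬sq
    ... | no ¬sq | yes sq  = contradiction (subst Square (sym eq) (square+1 sq)) ¬sq
    ... | no _   | no _    = eq

    -- `shift` fixes the nonsquares, and 0 is not one of them, so the element sent to 0 is a square
    -- i² with i² + 1 = 0.
    -1-square : ∃ λ i → i * i + 1# ≡ 0#
    -1-square = root (injective⇒surjective shift-injective 0#)
      where
      root : (∃ λ x → shift x ≡ 0#) → ∃ λ i → i * i + 1# ≡ 0#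
      root (x , shift≡0) with square? x
      ... | yes (i , refl) = i , shift≡0
      ... | no ¬sq         = contradiction shift≡0 (nonsquare⇒≢0 ¬sq)

    difference : ∀ {i h} → i * i + 1# ≡ 0# → (1# + 1#) * h ≡ 1# → ∀ z →
                 let u = (z + 1#) * h; w = (z - 1#) * h in u * u + (i * w) * (i * w) ≡ z
    difference {i} {h} i²+1≡0 2h≡1 z = begin
      u * u + (i * w) * (i * w)
        ≡⟨ solve 3 (λ u i w → u :* u :+ (i :* w) :* (i :* w)
             := (i :* i :+ :1) :* (w :* w) :+ (u :+ :- w) :* (u :+ w)) refl u i w ⟩
      (i * i + 1#) * (w * w) + (u - w) * (u + w)
        ≡⟨ cong₂ (λ a b → a * (w * w) + b) i²+1≡0 (cong₂ _*_ u-w≡1 u+w≡z) ⟩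
      0# * (w * w) + 1# * z
        ≡⟨ cong₂ _+_ (zeroˡ (w * w)) (*-identityˡ z) ⟩
      0# + z
        ≡⟨ +-identityˡ z ⟩
      z ∎
      where
      u w : Carrier
      u = (z + 1#) * h
      w = (z - 1#) * h
      u-w≡1 : u - w ≡ 1#
      u-w≡1 = trans (solve 2 (λ z h → (z :+ :1) :* h :+ :- ((z :+ :- :1) :* h) := (:1 :+ :1) :* h) refl z h) 2h≡1
      u+w≡z : u + w ≡ z
      u+w≡z = trans (solve 2 (λ z h → (z :+ :1) :* h :+ (z :+ :- :1) :* h := ((:1 :+ :1) :* h) :* z) refl z h)
                    (trans (cong (_* z) 2h≡1) (*-identityˡ z))

    all-squares : ∀ z → Square z
    all-squares z =
      let i , i²+1≡0 = -1-square
          h , 2h≡1   = inverse (1# + 1#) 1+1≢0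
      in subst Square (difference i²+1≡0 2h≡1 z) (closed ((z + 1#) * h) (i * ((z - 1#) * h)))

  -- If g is a nonsquare, it is itself such a value. If g = e², scaling y by the inverse of e
  -- reduces the form to a sum of two squares. The result supplies the multiplier of `Rotation`.
  nonsquare-value : ∀ {g} → g ≢ 0# → ∃ λ ((x , y) : Carrier × Carrier) → ¬ Square (x * x + g * (y * y))
  nonsquare-value {g} g≢0 with square? g
  ... | no ¬sq = (0# , 1#) , ¬sq ∘ subst Square (trans (cong₂ _+_ (zeroʳ 0#) (trans (cong (g *_) (*-identityʳ 1#)) (*-identityʳ g))) (+-identityˡ g))
  ... | yes (e , refl) with (x , y) , ¬sq ← nonsquare-sum-of-squares
                         | e⁻¹ , ee⁻¹≡1 ← inverse e (λ { refl → g≢0 (zeroʳ 0#) }) =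
    (x , e⁻¹ * y) , ¬sq ∘ subst Square (cong (x * x +_) (begin
      (e * e) * ((e⁻¹ * y) * (e⁻¹ * y))
        ≡⟨ solve 3 (λ e i y → (e :* e) :* ((i :* y) :* (i :* y)) := (e :* i) :* ((e :* i) :* (y :* y))) refl e e⁻¹ y ⟩
      (e * e⁻¹) * ((e * e⁻¹) * (y * y))
        ≡⟨ cong (λ u → u * (u * (y * y))) ee⁻¹≡1 ⟩
      1# * (1# * (y * y))
        ≡⟨ trans (*-identityˡ _) (*-identityˡ _) ⟩
      y * y ∎))

any≡does-any? : ∀ {A : Set} {P : A → Set} (P? : Decidable P) xs →
                any (λ x → does (P? x)) xs ≡ does (any? P? xs)
any≡does-any? P? []       = refl
any≡does-any? P? (x ∷ xs) = cong (does (P? x) ∨_) (any≡does-any? P? xs)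

-- The arc value as a function of the value of the form.

module QuadraticCharacter (𝔽 : FiniteField) (m : ℕ) (odd : FiniteField.size 𝔽 ≡ suc (m ℕ.+ m))
                          (α β : ℕ) (α+β≡1 : α ℕ.+ β ≡ 1) where
  open FieldTheory 𝔽
  open OddField 𝔽 m odd
  open Geometry 𝔽 using (q; half; isZero; isSquareᵇ)
  open ≡-Reasoning

  half+half≡1+q : half ℕ.+ half ≡ suc q
  half+half≡1+q = begin
    half ℕ.+ half    ≡⟨ cong (λ h → h ℕ.+ h) half≡1+m ⟩
    suc m ℕ.+ suc m  ≡⟨ cong suc (ℕ.+-suc m m) ⟩
    suc (suc (m ℕ.+ m)) ≡⟨ cong suc odd ⟨
    suc q            ∎
    where
    double : ∀ n → suc (n ℕ.+ n) ℕ.+ 1 ≡ suc n ℕ.* 2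
    double = solve-∀

    half≡1+m : half ≡ suc m
    half≡1+m = trans (cong (λ n → (n ℕ.+ 1) / 2) odd)
                     (trans (cong (_/ 2) (double m)) (m*n/n≡m (suc m) 2))

  isSquareᵇ≡does : ∀ x → isSquareᵇ x ≡ does (square? x)
  isSquareᵇ≡does x = any≡does-any? (λ y → (y * y) ≟ x) elements

  -- With `α` on nonzero squares and `β` on nonsquares, one argument serves both arcs: for suitable
  -- constants `κ ∘ evalQ F` is definitionally `K₁ F` or `K₂ F`.
  κ : Carrier → ℕ
  κ x = if isZero x then half else (if isSquareᵇ x then α else β)

  κ-zero : κ 0# ≡ half
  κ-zero rewrite dec-true (0# ≟ 0#) refl = refl

  κ-square : ∀ {x} → x ≢ 0# → Square x → κ x ≡ α
  κ-square {x} x≢0 sq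
    rewrite dec-false (x ≟ 0#) x≢0 | isSquareᵇ≡does x | dec-true (square? x) sq = refl

  κ-nonsquare : ∀ {x} → ¬ Square x → κ x ≡ β
  κ-nonsquare {x} ¬sq
    rewrite dec-false (x ≟ 0#) (nonsquare⇒≢0 ¬sq) | isSquareᵇ≡does x | dec-false (square? x) ¬sq = refl

  κ-scale : ∀ {c} x → c ≢ 0# → κ ((c * c) * x) ≡ κ x
  κ-scale {c} x c≢0 = by-cases (x ≟ 0#) (square? x)
    where
    by-cases : Dec (x ≡ 0#) → Dec (Square x) → κ ((c * c) * x) ≡ κ x
    by-cases (yes x≡0) _        = cong κ (trans (cong ((c * c) *_) x≡0) (trans (zeroʳ (c * c)) (sym x≡0)))
    by-cases (no x≢0)  (yes sq) = trans (κ-square (*-nonzero (*-nonzero c≢0 c≢0) x≢0) (square-scale c sq))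
                                        (sym (κ-square x≢0 sq))
    by-cases (no _)    (no ¬sq) = trans (κ-nonsquare (¬sq ∘ square-quotient c≢0)) (sym (κ-nonsquare ¬sq))

  -- Multiplication by `ε` exchanges nonzero squares and nonsquares, so a nonzero x gives α + β = 1,
  -- while 0 gives 2 · `half` = 1 + q.
  κ-twist : ∀ {ε} → ¬ Square ε → ∀ x → κ x ℕ.+ κ (ε * x) ≡ 1 ℕ.+ q ℕ.* 𝟙 (isZero x)
  κ-twist {ε} ε-nonsq x = by-cases (x ≟ 0#) (square? x)
    where
    by-cases : Dec (x ≡ 0#) → Dec (Square x) → κ x ℕ.+ κ (ε * x) ≡ 1 ℕ.+ q ℕ.* 𝟙 (isZero x)
    by-cases (yes refl) _ = begin
      κ 0# ℕ.+ κ (ε * 0#)  ≡⟨ cong₂ ℕ._+_ κ-zero (trans (cong κ (zeroʳ ε)) κ-zero) ⟩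
      half ℕ.+ half        ≡⟨ half+half≡1+q ⟩
      1 ℕ.+ q              ≡⟨ cong suc (ℕ.*-identityʳ q) ⟨
      1 ℕ.+ q ℕ.* 1        ≡⟨ cong (λ b → 1 ℕ.+ q ℕ.* 𝟙 b) (dec-true (0# ≟ 0#) refl) ⟨
      1 ℕ.+ q ℕ.* 𝟙 (isZero 0#) ∎
    by-cases (no x≢0) (yes sq) = trans
      (cong₂ ℕ._+_ (κ-square x≢0 sq) (κ-nonsquare (nonsquare*square ε-nonsq x≢0 sq)))
      (trans α+β≡1 units)
      where
      units : 1 ≡ 1 ℕ.+ q ℕ.* 𝟙 (isZero x)
      units rewrite dec-false (x ≟ 0#) x≢0 = cong suc (sym (ℕ.*-zeroʳ q))
    by-cases (no x≢0) (no ¬sq) = trans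
      (cong₂ ℕ._+_ (κ-nonsquare ¬sq)
        (κ-square (*-nonzero (nonsquare⇒≢0 ε-nonsq) x≢0) (nonsquare*nonsquare ε-nonsq ¬sq)))
      (trans (ℕ.+-comm β α) (trans α+β≡1 units))
      where
      units : 1 ≡ 1 ℕ.+ q ℕ.* 𝟙 (isZero x)
      units rewrite dec-false (x ≟ 0#) x≢0 = cong suc (sym (ℕ.*-zeroʳ q))

module Pairs (𝔽 : FiniteField) where
  open FieldTheory 𝔽 using (Carrier; elements; complete; unique; _≟_)

  pairs : List (Carrier × Carrier)
  pairs = cartesianProduct elements elements

  _≟²_ : DecidableEquality (Carrier × Carrier)
  _≟²_ = ≡-dec _≟_ _≟_

  open Finite _≟²_ pairs (λ (x , y) → ∈-cartesianProduct⁺ (complete x) (complete y))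
              (cartesianProduct⁺ unique unique) public

-- Totals of binary quadratic forms over the plane.

module BinaryForms (𝔽 : FiniteField) (m : ℕ) (odd : FiniteField.size 𝔽 ≡ suc (m ℕ.+ m))
                   (α β : ℕ) (α+β≡1 : α ℕ.+ β ≡ 1) where
  open FieldTheory 𝔽
  open OddField 𝔽 m odd
  open QuadraticCharacter 𝔽 m odd α β α+β≡1
  open Geometry 𝔽 using (q; half; isZero)
  private module P = Pairs 𝔽
  open P using (pairs)
  open ≡-Reasoning

  -- `half` is an inverse of 2 modulo q: `half` times 2 n equals n q + n.
  q∣n+n⇒q∣n : ∀ n → q ∣ n ℕ.+ n → q ∣ n
  q∣n+n⇒q∣n n q∣n+n = ∣m+n∣m⇒∣n (subst (q ∣_) eq (∣n⇒∣m*n half q∣n+n)) (∣n⇒∣m*n n ∣-refl)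
    where
    regroup : ∀ h n → h ℕ.* (n ℕ.+ n) ≡ n ℕ.* (h ℕ.+ h)
    regroup = solve-∀
    eq : half ℕ.* (n ℕ.+ n) ≡ n ℕ.* q ℕ.+ n
    eq = trans (regroup half n) (trans (cong (n ℕ.*_) half+half≡1+q)
               (trans (ℕ.*-suc n q) (ℕ.+-comm n (n ℕ.* q))))

  total : (Carrier × Carrier → Carrier) → ℕ
  total f = Sum pairs (κ ∘ f)

  -- The free coordinate repeats each value q times. Together with its mirror image below, this
  -- covers the forms of rank at most 1.
  q∣total-∘proj₁ : ∀ g → q ∣ total (g ∘ proj₁)
  q∣total-∘proj₁ g = subst (q ∣_) (sym eq) (m∣m*n _)
    where
    eq : total (g ∘ proj₁) ≡ q ℕ.* Sum elements (κ ∘ g)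
    eq = trans (Sum-cartesianProduct elements elements _)
      (trans (Sum-cong elements (λ x → Sum-const elements (κ (g x)))) (Sum-*ˡ elements q (κ ∘ g)))

  q∣total-∘proj₂ : ∀ g → q ∣ total (g ∘ proj₂)
  q∣total-∘proj₂ g = subst (q ∣_) (sym eq) (m∣m*n _)
    where
    eq : total (g ∘ proj₂) ≡ q ℕ.* Sum elements (κ ∘ g)
    eq = trans (Sum-cartesianProduct elements elements _) (Sum-const elements _)

  similitude⇒q∣total : ∀ {f φ ε} → Injective _≡_ _≡_ φ → ¬ Square ε →
                       (∀ p → f (φ p) ≡ ε * f p) → q ∣ total f
  similitude⇒q∣total {f} {φ} {ε} φ-inj ε-nonsq fφ≡εf =
    q∣n+n⇒q∣n (total f) (subst (q ∣_) (sym eq) (∣m∣n⇒∣m+n (m∣m*n _) (m∣m*n _)))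
    where
    zeros : ℕ
    zeros = Sum pairs (𝟙 ∘ isZero ∘ f)

    eq : total f ℕ.+ total f ≡ q ℕ.* (q ℕ.* 1) ℕ.+ q ℕ.* zeros
    eq = begin
      total f ℕ.+ total f
        ≡⟨ cong (total f ℕ.+_) (P.Sum-reindex φ-inj (κ ∘ f)) ⟨
      total f ℕ.+ total (f ∘ φ)
        ≡⟨ Sum-+ pairs (κ ∘ f) (κ ∘ f ∘ φ) ⟨
      Sum pairs (λ p → κ (f p) ℕ.+ κ (f (φ p)))
        ≡⟨ Sum-cong pairs (λ p → trans (cong (λ z → κ (f p) ℕ.+ κ z) (fφ≡εf p)) (κ-twist ε-nonsq (f p))) ⟩
      Sum pairs (λ p → 1 ℕ.+ q ℕ.* 𝟙 (isZero (f p)))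
        ≡⟨ Sum-+ pairs (λ _ → 1) _ ⟩
      Sum pairs (λ _ → 1) ℕ.+ Sum pairs (λ p → q ℕ.* 𝟙 (isZero (f p)))
        ≡⟨ cong₂ ℕ._+_ (trans (Sum-cartesianProduct elements elements (λ _ → 1))
             (trans (Sum-const elements _) (cong (q ℕ.*_) (Sum-const elements 1))))
             (Sum-*ˡ pairs q (𝟙 ∘ isZero ∘ f)) ⟩
      q ℕ.* (q ℕ.* 1) ℕ.+ q ℕ.* zeros ∎

  total-cong : ∀ {f g} → (∀ p → f p ≡ g p) → total f ≡ total g
  total-cong f≗g = Sum-cong pairs (λ p → cong κ (f≗g p))

  -- (s , t) ↦ (x s - b y t , x t + a y s) multiplies a s² + b t² by x² + a b y².
  module Rotation (a b x y : Carrier) (nonsq : ¬ Square (x * x + (a * b) * (y * y))) where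
    N : Carrier
    N = x * x + (a * b) * (y * y)

    N≢0 : N ≢ 0#
    N≢0 = nonsquare⇒≢0 nonsq

    φ : Carrier × Carrier → Carrier × Carrier
    φ (s , t) = (x * s - b * y * t) , (x * t + a * y * s)

    multiplier : ∀ ((s , t) : Carrier × Carrier) → let s′ , t′ = φ (s , t) in
                 a * (s′ * s′) + b * (t′ * t′) ≡ N * (a * (s * s) + b * (t * t))
    multiplier (s , t) =
      solve 6 (λ a b x y s t →
        a :* ((x :* s :+ :- (b :* y :* t)) :* (x :* s :+ :- (b :* y :* t)))
          :+ b :* ((x :* t :+ a :* y :* s) :* (x :* t :+ a :* y :* s))
        := (x :* x :+ (a :* b) :* (y :* y)) :* (a :* (s :* s) :+ b :* (t :* t))) refl a b x y s t

    -- The coefficients here and in `recover₂` are the rows of the adjugate of the matrix of `φ`,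
    -- whose determinant is again `N`.
    recover₁ : ∀ s t → x * (x * s - b * y * t) + b * y * (x * t + a * y * s) ≡ N * s
    recover₁ = solve 6 (λ a b x y s t →
      x :* (x :* s :+ :- (b :* y :* t)) :+ b :* y :* (x :* t :+ a :* y :* s)
      := (x :* x :+ (a :* b) :* (y :* y)) :* s) refl a b x y

    recover₂ : ∀ s t → x * (x * t + a * y * s) - a * y * (x * s - b * y * t) ≡ N * t
    recover₂ = solve 6 (λ a b x y s t →
      x :* (x :* t :+ a :* y :* s) :+ :- (a :* y :* (x :* s :+ :- (b :* y :* t)))
      := (x :* x :+ (a :* b) :* (y :* y)) :* t) refl a b x y

    φ-injective : Injective _≡_ _≡_ φ
    φ-injective {s , t} {s′ , t′} eq = cong₂ _,_
      (*-cancelˡ N≢0 (trans (sym (recover₁ s t))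
        (trans (cong (λ p → x * proj₁ p + b * y * proj₂ p) eq) (recover₁ s′ t′))))
      (*-cancelˡ N≢0 (trans (sym (recover₂ s t))
        (trans (cong (λ p → x * proj₂ p - a * y * proj₁ p) eq) (recover₂ s′ t′))))

  -- For a ≠ 0 the product a b is nonzero, so x² + a b y² takes a nonsquare value and `Rotation`
  -- provides a similitude. For a = 0 the variable s is free.
  diagonal : ∀ a b → b ≢ 0# → q ∣ total (λ (s , t) → a * (s * s) + b * (t * t))
  diagonal a b b≢0 = by-cases (a ≟ 0#)
    where
    by-cases : Dec (a ≡ 0#) → q ∣ total (λ (s , t) → a * (s * s) + b * (t * t))
    by-cases (yes a≡0) = subst (q ∣_)
      (total-cong {λ (s , t) → b * (t * t)} {λ (s , t) → a * (s * s) + b * (t * t)}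
        (λ (s , t) → sym (trans (cong (λ z → z * (s * s) + b * (t * t)) a≡0)
        (trans (cong (_+ b * (t * t)) (zeroˡ (s * s))) (+-identityˡ (b * (t * t)))))))
      (q∣total-∘proj₂ (λ t → b * (t * t)))
    by-cases (no a≢0) =
      let (x , y) , nonsq = nonsquare-value (*-nonzero a≢0 b≢0)
          open Rotation a b x y nonsq
      in similitude⇒q∣total {λ (s , t) → a * (s * s) + b * (t * t)} {φ} {N} φ-injective nonsq multiplier

  form : Carrier → Carrier → Carrier → Carrier × Carrier → Carrier
  form A B C (s , t) = A * (s * s) + B * (s * t) + C * (t * t)

  -- Completing the square.
  module Shear (A B C k : Carrier) (2Ck≡B : (C + C) * k ≡ B) where
    σ : Carrier × Carrier → Carrier × Carrier
    σ (s , t) = s , (t - k * s)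

    σ-injective : Injective _≡_ _≡_ σ
    σ-injective {s , t} {s′ , t′} eq = cong₂ _,_ (cong proj₁ eq)
      (+-cancelʳ (- (k * s)) (trans (cong proj₂ eq) (cong (λ z → t′ - k * z) (sym (cong proj₁ eq)))))

    diagonalised : ∀ p → (A - C * (k * k)) * (proj₁ p * proj₁ p) + C * (proj₂ p * proj₂ p) ≡ form A B C (σ p)
    diagonalised (s , t) = trans
      (solve 5 (λ A C k s t →
        (A :+ :- (C :* (k :* k))) :* (s :* s) :+ C :* (t :* t)
        := A :* (s :* s) :+ ((C :+ C) :* k) :* (s :* (t :+ :- (k :* s)))
           :+ C :* ((t :+ :- (k :* s)) :* (t :+ :- (k :* s)))) refl A C k s t)
      (cong (λ b → form A b C (σ (s , t))) 2Ck≡B)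

  -- The map φ multiplies the factor s of s (A s + B t) by ε and preserves the other one.
  module Hyperbolic (A B b ε : Carrier) (Bb≡1 : B * b ≡ 1#) (ε≢0 : ε ≢ 0#) where
    φ : Carrier × Carrier → Carrier × Carrier
    φ (s , t) = (ε * s) , (t + b * (A * (s - ε * s)))

    φ-injective : Injective _≡_ _≡_ φ
    φ-injective {s , t} {s′ , t′} eq = cong₂ _,_ s≡s′
      (+-cancelʳ (b * (A * (s - ε * s)))
        (trans (cong proj₂ eq) (cong (λ z → t′ + b * (A * (z - ε * z))) (sym s≡s′))))
      where
      s≡s′ : s ≡ s′
      s≡s′ = *-cancelˡ ε≢0 (cong proj₁ eq)

    multiplier : ∀ p → form A B 0# (φ p) ≡ ε * form A B 0# p
    multiplier (s , t) = begin
      A * ((ε * s) * (ε * s)) + B * ((ε * s) * (t + b * w)) + 0# * ((t + b * w) * (t + b * w))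
        ≡⟨ cong (A * ((ε * s) * (ε * s)) + B * ((ε * s) * (t + b * w)) +_)
             (trans (zeroˡ _) (sym (trans (cong (ε *_) (zeroˡ (t * t))) (zeroʳ ε)))) ⟩
      A * ((ε * s) * (ε * s)) + B * ((ε * s) * (t + b * w)) + ε * (0# * (t * t))
        -- The solver does not know that `B * b ≡ 1#`. The product is first isolated with `w` as an
        -- atom, then replaced, and only afterwards is `w` expanded.
        ≡⟨ solve 8 (λ A B b e s t w z →
             A :* ((e :* s) :* (e :* s)) :+ B :* ((e :* s) :* (t :+ b :* w)) :+ e :* z
             := e :* (A :* (s :* (e :* s)) :+ B :* (s :* t) :+ z) :+ (B :* b) :* ((e :* s) :* w))
             refl A B b ε s t w (0# * (t * t)) ⟩
      ε * (A * (s * (ε * s)) + B * (s * t) + 0# * (t * t)) + (B * b) * ((ε * s) * w)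
        ≡⟨ cong (λ u → ε * (A * (s * (ε * s)) + B * (s * t) + 0# * (t * t)) + u * ((ε * s) * w)) Bb≡1 ⟩
      ε * (A * (s * (ε * s)) + B * (s * t) + 0# * (t * t)) + 1# * ((ε * s) * w)
        ≡⟨ solve 6 (λ A B e s t z →
             e :* (A :* (s :* (e :* s)) :+ B :* (s :* t) :+ z) :+ :1 :* ((e :* s) :* (A :* (s :+ :- (e :* s))))
             := e :* (A :* (s :* s) :+ B :* (s :* t) :+ z)) refl A B ε s t (0# * (t * t)) ⟩
      ε * (A * (s * s) + B * (s * t) + 0# * (t * t)) ∎
      where
      w : Carrier
      w = A * (s - ε * s)

  -- For C ≠ 0 the square in t can be completed. For C = 0 the form is s (A s + B t): two
  -- independent linear factors if B ≠ 0, a function of s alone if B = 0.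
  q∣total-form : ∀ A B C → q ∣ total (form A B C)
  q∣total-form A B C = by-cases (C ≟ 0#) (B ≟ 0#)
    where
    by-cases : Dec (C ≡ 0#) → Dec (B ≡ 0#) → q ∣ total (form A B C)
    by-cases (no C≢0) _ =
      let h , 2Ch≡1 = inverse (C + C) (λ 2C≡0 → *-nonzero 1+1≢0 C≢0
                        (trans (solve 1 (λ c → (:1 :+ :1) :* c := c :+ c) refl C) 2C≡0))
          k = h * B
          open Shear A B C k (trans (sym (*-assoc (C + C) h B)) (trans (cong (_* B) 2Ch≡1) (*-identityˡ B)))
      in subst (q ∣_)
           (trans (total-cong {λ (s , t) → (A - C * (k * k)) * (s * s) + C * (t * t)} {form A B C ∘ σ} diagonalised)
                  (P.Sum-reindex σ-injective (κ ∘ form A B C)))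
           (diagonal (A - C * (k * k)) C C≢0)
    by-cases (yes C≡0) (yes B≡0) = subst (q ∣_)
      (total-cong {λ (s , t) → A * (s * s)} {form A B C} (λ (s , t) → sym (begin
        A * (s * s) + B * (s * t) + C * (t * t)
          ≡⟨ cong₂ (λ u v → A * (s * s) + u + v) (trans (cong (_* (s * t)) B≡0) (zeroˡ (s * t)))
               (trans (cong (_* (t * t)) C≡0) (zeroˡ (t * t))) ⟩
        A * (s * s) + 0# + 0#
          ≡⟨ trans (+-identityʳ _) (+-identityʳ _) ⟩
        A * (s * s) ∎)))
      (q∣total-∘proj₁ (λ s → A * (s * s)))
    by-cases (yes C≡0) (no B≢0) =
      let b , Bb≡1 = inverse B B≢0
          ε , nonsq = nonsquare
          open Hyperbolic A B b ε Bb≡1 (nonsquare⇒≢0 nonsq)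
      in subst (λ c → q ∣ total (form A B c)) (sym C≡0) (similitude⇒q∣total {form A B 0#} {φ} {ε} φ-injective nonsq multiplier)

-- Vectors, canonical representatives and bilinear forms.

module Vectors (𝔽 : FiniteField) where
  open FieldTheory 𝔽
  open Geometry 𝔽 hiding (q)
  open ≡-Reasoning

  _≈?_ : ∀ {n} (u w : V n) → Dec (u ≈ w)
  _≈?_ {zero}  u w = yes λ ()
  _≈?_ {suc n} u w = map′ (λ { (eq , eqs) Fin.zero → eq ; (eq , eqs) (Fin.suc i) → eqs i })
                          (λ eqs → eqs Fin.zero , eqs ∘ Fin.suc)
                          ((u Fin.zero ≟ w Fin.zero) ×-dec (tail u ≈? tail w))

  eqVecᵇ≡does : ∀ {n} (u w : V n) → eqVecᵇ u w ≡ does (u ≈? w)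
  eqVecᵇ≡does {zero}  u w = refl
  eqVecᵇ≡does {suc n} u w = cong (does (u Fin.zero ≟ w Fin.zero) ∧_) (eqVecᵇ≡does (tail u) (tail w))

  infixl 7 _•_
  _•_ : ∀ {n} → Carrier → V n → V n
  (c • v) i = c * v i

  infixl 6 _⊕_
  _⊕_ : ∀ {n} → V n → V n → V n
  (u ⊕ w) i = u i + w i

  -- Vectors are functions, and pointwise equality does not yield `≡`, so respect for `≈` has to be
  -- carried as a property.
  Extensional : ∀ {n} {A : Set} → (V n → A) → Set
  Extensional f = ∀ {u w} → u ≈ w → f u ≡ f w

  -- `Finite` asks for a decidable `≡`, which is not at hand for functions. The selection of a
  -- single term is therefore redone for `≈`, one coordinate at a time.
  Sum-allVecs-δ : ∀ n (w : V n) {g : V n → ℕ} → Extensional g →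
                  Sum (allVecs n) (λ v → 𝟙 (does (w ≈? v)) ℕ.* g v) ≡ g w
  Sum-allVecs-δ zero    w {g} g-ext = trans (ℕ.+-identityʳ _) (trans (ℕ.*-identityˡ _) (g-ext λ ()))
  Sum-allVecs-δ (suc n) w {g} g-ext = begin
    Sum (allVecs (suc n)) (λ v → 𝟙 (does (w ≈? v)) ℕ.* g v)
      ≡⟨ Sum-concatMap (λ x → map (x ∷ᶠ_) (allVecs n)) elements _ ⟩
    Sum elements (λ x → Sum (map (x ∷ᶠ_) (allVecs n)) (λ v → 𝟙 (does (w ≈? v)) ℕ.* g v))
      ≡⟨ Sum-cong elements (λ x → trans (Sum-map (x ∷ᶠ_) (allVecs n) _) (fixed-head x)) ⟩
    Sum elements (λ x → 𝟙 (does (x ≟ w Fin.zero)) ℕ.* g (x ∷ᶠ tail w))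
      ≡⟨ Sum-δ (w Fin.zero) (λ x → g (x ∷ᶠ tail w)) ⟩
    g (w Fin.zero ∷ᶠ tail w)
      ≡⟨ g-ext (λ { Fin.zero → refl ; (Fin.suc i) → refl }) ⟩
    g w ∎
    where
    fixed-head : ∀ x → Sum (allVecs n) (λ v → 𝟙 (does (w ≈? (x ∷ᶠ v))) ℕ.* g (x ∷ᶠ v))
                     ≡ 𝟙 (does (x ≟ w Fin.zero)) ℕ.* g (x ∷ᶠ tail w)
    fixed-head x = begin
      Sum (allVecs n) (λ v → 𝟙 (does (w ≈? (x ∷ᶠ v))) ℕ.* g (x ∷ᶠ v))
        ≡⟨ Sum-cong (allVecs n) (λ v → trans
             (cong (ℕ._* g (x ∷ᶠ v)) (trans (𝟙-∧ (does (w Fin.zero ≟ x)) (does (tail w ≈? v)))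
               (cong (λ b → 𝟙 b ℕ.* 𝟙 (does (tail w ≈? v))) (does-⇔ (mk⇔ sym sym) (w Fin.zero ≟ x) (x ≟ w Fin.zero)))))
             (ℕ.*-assoc (𝟙 (does (x ≟ w Fin.zero))) (𝟙 (does (tail w ≈? v))) (g (x ∷ᶠ v)))) ⟩
      Sum (allVecs n) (λ v → 𝟙 (does (x ≟ w Fin.zero)) ℕ.* (𝟙 (does (tail w ≈? v)) ℕ.* g (x ∷ᶠ v)))
        ≡⟨ Sum-*ˡ (allVecs n) (𝟙 (does (x ≟ w Fin.zero))) _ ⟩
      𝟙 (does (x ≟ w Fin.zero)) ℕ.* Sum (allVecs n) (λ v → 𝟙 (does (tail w ≈? v)) ℕ.* g (x ∷ᶠ v))
        ≡⟨ cong (𝟙 (does (x ≟ w Fin.zero)) ℕ.*_) (Sum-allVecs-δ n (tail w)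
             (λ u≈v → g-ext λ { Fin.zero → refl ; (Fin.suc i) → u≈v i })) ⟩
      𝟙 (does (x ≟ w Fin.zero)) ℕ.* g (x ∷ᶠ tail w) ∎

  normalized-cong : ∀ {n} → Extensional (normalized {n})
  normalized-cong {zero}  u≈w = refl
  normalized-cong {suc n} u≈w rewrite u≈w Fin.zero | normalized-cong (u≈w ∘ Fin.suc) = refl

  normalized-𝟎 : ∀ n → normalized (𝟎 {n}) ≡ false
  normalized-𝟎 zero    = refl
  normalized-𝟎 (suc n) rewrite dec-true (0# ≟ 0#) refl = normalized-𝟎 n

  point≉𝟎 : ∀ {n} {v : V n} → IsPoint v → ¬ (v ≈ 𝟎)
  point≉𝟎 {n} v-point v≈𝟎 with () ← trans (sym v-point) (trans (normalized-cong v≈𝟎) (normalized-𝟎 n))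

  normalized-head≡0 : ∀ {n} (v : V (suc n)) → head v ≡ 0# → normalized v ≡ normalized (tail v)
  normalized-head≡0 v v₀≡0 rewrite dec-true (head v ≟ 0#) v₀≡0 = refl

  normalized-head≢0 : ∀ {n} (v : V (suc n)) → head v ≢ 0# → normalized v ≡ does (head v ≟ 1#)
  normalized-head≢0 v v₀≢0 rewrite dec-false (head v ≟ 0#) v₀≢0 = refl

  -- `c₀` is the inverse of the first nonzero coordinate. The Boolean equation, valid at c = 0 too,
  -- lets `Sum-δ` count the canonical multiples of v directly.
  normalizer : ∀ {n} (v : V n) → ¬ (v ≈ 𝟎) →
               ∃ λ c₀ → c₀ ≢ 0# × (∀ c → normalized (c • v) ≡ does (c ≟ c₀))
  normalizer {zero}  v v≉𝟎 = contradiction (λ ()) v≉𝟎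
  normalizer {suc n} v v≉𝟎 = by-cases (v Fin.zero ≟ 0#)
    where
    v₀ : Carrier
    v₀ = v Fin.zero

    by-cases : Dec (v₀ ≡ 0#) → ∃ λ c₀ → c₀ ≢ 0# × (∀ c → normalized (c • v) ≡ does (c ≟ c₀))
    by-cases (yes v₀≡0) =
      let c₀ , c₀≢0 , eq = normalizer (tail v) (λ tail≈𝟎 → v≉𝟎 λ { Fin.zero → v₀≡0 ; (Fin.suc i) → tail≈𝟎 i })
      in c₀ , c₀≢0 , λ c → trans (normalized-head≡0 (c • v) (trans (cong (c *_) v₀≡0) (zeroʳ c))) (eq c)
    by-cases (no v₀≢0) =
      let v₀⁻¹ , v₀v₀⁻¹≡1 = inverse v₀ v₀≢0
      in v₀⁻¹ , factor≢0 v₀v₀⁻¹≡1 , λ c → stop v₀⁻¹ v₀v₀⁻¹≡1 c (c ≟ 0#)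
      where
      factor≢0 : ∀ {i} → v₀ * i ≡ 1# → i ≢ 0#
      factor≢0 v₀i≡1 i≡0 = 0≢1 (trans (sym (zeroʳ v₀)) (trans (cong (v₀ *_) (sym i≡0)) v₀i≡1))

      stop : ∀ i → v₀ * i ≡ 1# → ∀ c → Dec (c ≡ 0#) → normalized (c • v) ≡ does (c ≟ i)
      stop i v₀i≡1 c (yes c≡0) = trans
        (trans (normalized-cong {suc n} {c • v} {𝟎} (λ j → trans (cong (_* v j) c≡0) (zeroˡ (v j))))
               (normalized-𝟎 (suc n)))
        (sym (dec-false (c ≟ i) (λ c≡i → factor≢0 v₀i≡1 (trans (sym c≡i) c≡0))))
      stop i v₀i≡1 c (no c≢0) = trans (normalized-head≢0 (c • v) (*-nonzero c≢0 v₀≢0))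
        (does-⇔ (mk⇔ (λ cv₀≡1 → *-cancelˡ v₀≢0 (trans (*-comm v₀ c) (trans cv₀≡1 (sym v₀i≡1))))
                     (λ c≡i → trans (*-comm c v₀) (trans (cong (v₀ *_) c≡i) v₀i≡1)))
                ((c * v₀) ≟ 1#) (c ≟ i))

  ∑-cong : ∀ {k} {f g : Fin k → Carrier} → (∀ i → f i ≡ g i) → ∑ f ≡ ∑ g
  ∑-cong {zero}  f≗g = refl
  ∑-cong {suc k} f≗g = cong₂ _+_ (f≗g Fin.zero) (∑-cong (f≗g ∘ Fin.suc))

  ∑-+ : ∀ {k} (f g : Fin k → Carrier) → ∑ (λ i → f i + g i) ≡ ∑ f + ∑ g
  ∑-+ {zero}  f g = sym (+-identityʳ 0#)
  ∑-+ {suc k} f g = trans (cong (f Fin.zero + g Fin.zero +_) (∑-+ (f ∘ Fin.suc) (g ∘ Fin.suc)))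
    (solve 4 (λ a b c d → (a :+ b) :+ (c :+ d) := (a :+ c) :+ (b :+ d)) refl _ _ _ _)

  ∑-* : ∀ {k} c (f : Fin k → Carrier) → ∑ (λ i → c * f i) ≡ c * ∑ f
  ∑-* {zero}  c f = sym (zeroʳ c)
  ∑-* {suc k} c f = trans (cong (c * f Fin.zero +_) (∑-* c (f ∘ Fin.suc)))
    (solve 3 (λ c a b → c :* a :+ c :* b := c :* (a :+ b)) refl c (f Fin.zero) _)

  -- The matrix may be asymmetric, so the two argument orders are kept apart and `polar` is their
  -- sum. On the diagonal this is `evalQ` by definition.
  bilinear : ∀ {n} → QuadForm n → V n → V n → Carrier
  bilinear a x y = ∑ (λ i → ∑ (λ j → a i j * (x i * y j)))

  module _ {n} (a : QuadForm n) where

    bilinear-cong : ∀ {x x′ y y′} → x ≈ x′ → y ≈ y′ → bilinear a x y ≡ bilinear a x′ y′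
    bilinear-cong x≈x′ y≈y′ = ∑-cong λ i → ∑-cong λ j → cong (a i j *_) (cong₂ _*_ (x≈x′ i) (y≈y′ j))

    bilinear-⊕ˡ : ∀ x y z → bilinear a (x ⊕ y) z ≡ bilinear a x z + bilinear a y z
    bilinear-⊕ˡ x y z = trans (∑-cong λ i → trans
      (∑-cong λ j → solve 4 (λ a x y z → a :* ((x :+ y) :* z) := a :* (x :* z) :+ a :* (y :* z)) refl (a i j) (x i) (y i) (z j))
      (∑-+ {n} _ _)) (∑-+ {n} _ _)

    bilinear-⊕ʳ : ∀ x y z → bilinear a x (y ⊕ z) ≡ bilinear a x y + bilinear a x z
    bilinear-⊕ʳ x y z = trans (∑-cong λ i → trans
      (∑-cong λ j → solve 4 (λ a x y z → a :* (x :* (y :+ z)) := a :* (x :* y) :+ a :* (x :* z)) refl (a i j) (x i) (y j) (z j))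
      (∑-+ {n} _ _)) (∑-+ {n} _ _)

    bilinear-•ˡ : ∀ c x y → bilinear a (c • x) y ≡ c * bilinear a x y
    bilinear-•ˡ c x y = trans (∑-cong λ i → trans
      (∑-cong λ j → solve 4 (λ a c x y → a :* ((c :* x) :* y) := c :* (a :* (x :* y))) refl (a i j) c (x i) (y j))
      (∑-* {n} c _)) (∑-* {n} c (λ i → ∑ (λ j → a i j * (x i * y j))))

    bilinear-•ʳ : ∀ c x y → bilinear a x (c • y) ≡ c * bilinear a x y
    bilinear-•ʳ c x y = trans (∑-cong λ i → trans
      (∑-cong λ j → solve 4 (λ a c x y → a :* (x :* (c :* y)) := c :* (a :* (x :* y))) refl (a i j) c (x i) (y j))
      (∑-* {n} c _)) (∑-* {n} c (λ i → ∑ (λ j → a i j * (x i * y j))))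

    evalQ-cong : Extensional (evalQ a)
    evalQ-cong x≈y = bilinear-cong x≈y x≈y

    evalQ-• : ∀ c x → evalQ a (c • x) ≡ (c * c) * evalQ a x
    evalQ-• c x = trans (bilinear-•ˡ c x (c • x)) (trans (cong (c *_) (bilinear-•ʳ c x x)) (sym (*-assoc c c _)))

    evalQ-𝟎 : evalQ a 𝟎 ≡ 0#
    evalQ-𝟎 = trans (evalQ-cong {𝟎} {0# • 𝟎} (λ _ → sym (zeroʳ 0#)))
      (trans (evalQ-• 0# 𝟎) (trans (cong (_* evalQ a 𝟎) (zeroʳ 0#)) (zeroˡ (evalQ a 𝟎))))

    evalQ-⊕ : ∀ x y → evalQ a (x ⊕ y) ≡ evalQ a x + (bilinear a x y + bilinear a y x) + evalQ a y
    evalQ-⊕ x y = trans (bilinear-⊕ˡ x y (x ⊕ y))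
      (trans (cong₂ _+_ (bilinear-⊕ʳ x x y) (bilinear-⊕ʳ y x y))
      (solve 4 (λ a b c d → (a :+ b) :+ (c :+ d) := a :+ (b :+ c) :+ d) refl _ _ _ _))

    polar-bilinear : ∀ x y → polar a x y ≡ bilinear a x y + bilinear a y x
    polar-bilinear x y = trans (cong (_+ (- evalQ a x + - evalQ a y)) (evalQ-⊕ x y))
      (solve 3 (λ p b r → (p :+ b :+ r) :+ (:- p :+ :- r) := b) refl _ _ _)

    polar-⊕ʳ : ∀ x y z → polar a x (y ⊕ z) ≡ polar a x y + polar a x z
    polar-⊕ʳ x y z = begin
      polar a x (y ⊕ z)
        ≡⟨ polar-bilinear x (y ⊕ z) ⟩
      bilinear a x (y ⊕ z) + bilinear a (y ⊕ z) x
        ≡⟨ cong₂ _+_ (bilinear-⊕ʳ x y z) (bilinear-⊕ˡ y z x) ⟩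
      (bilinear a x y + bilinear a x z) + (bilinear a y x + bilinear a z x)
        ≡⟨ solve 4 (λ a b c d → (a :+ b) :+ (c :+ d) := (a :+ c) :+ (b :+ d)) refl _ _ _ _ ⟩
      (bilinear a x y + bilinear a y x) + (bilinear a x z + bilinear a z x)
        ≡⟨ cong₂ _+_ (polar-bilinear x y) (polar-bilinear x z) ⟨
      polar a x y + polar a x z ∎

    polar-•ʳ : ∀ c x y → polar a x (c • y) ≡ c * polar a x y
    polar-•ʳ c x y = begin
      polar a x (c • y)
        ≡⟨ polar-bilinear x (c • y) ⟩
      bilinear a x (c • y) + bilinear a (c • y) x
        ≡⟨ cong₂ _+_ (bilinear-•ʳ c x y) (bilinear-•ˡ c y x) ⟩
      c * bilinear a x y + c * bilinear a y x
        ≡⟨ solve 3 (λ c x y → c :* x :+ c :* y := c :* (x :+ y)) refl _ _ _ ⟩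
      c * (bilinear a x y + bilinear a y x)
        ≡⟨ cong (c *_) (polar-bilinear x y) ⟨
      c * polar a x y ∎

    evalQ-⊕-• : ∀ t x y → evalQ a (x ⊕ t • y) ≡ evalQ a x + t * polar a y x + (t * t) * evalQ a y
    evalQ-⊕-• t x y = begin
      evalQ a (x ⊕ t • y)
        ≡⟨ evalQ-⊕ x (t • y) ⟩
      evalQ a x + (bilinear a x (t • y) + bilinear a (t • y) x) + evalQ a (t • y)
        ≡⟨ cong₂ (λ b e → evalQ a x + b + e)
             (trans (cong₂ _+_ (bilinear-•ʳ t x y) (bilinear-•ˡ t y x))
               (trans (solve 3 (λ c x y → c :* x :+ c :* y := c :* (y :+ x)) refl _ _ _)
                 (cong (t *_) (sym (polar-bilinear y x)))))
             (evalQ-• t y) ⟩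
      evalQ a x + t * polar a y x + (t * t) * evalQ a y ∎

-- Line sums as sums over coefficient pairs.

module LineSums (𝔽 : FiniteField) where
  open FieldTheory 𝔽
  open Vectors 𝔽
  open Geometry 𝔽
  private module P = Pairs 𝔽
  open P using (pairs; _≟²_)
  open ≡-Reasoning

  module _ {n} (u w : V n) where

    comb : Carrier × Carrier → V n
    comb (a , b) i = a * u i + b * w i

    inSpan2? : ∀ v → Dec (Any (λ a → Any (λ b → comb (a , b) ≈ v) elements) elements)
    inSpan2? v = any? (λ a → any? (λ b → comb (a , b) ≈? v) elements) elements

    inSpan2ᵇ≡does : ∀ v → inSpan2ᵇ u w v ≡ does (inSpan2? v)
    inSpan2ᵇ≡does v = trans
      (any-cong (λ a → trans (any-cong (λ b → eqVecᵇ≡does (comb (a , b)) v) elements)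
                             (any≡does-any? (λ b → comb (a , b) ≈? v) elements)) elements)
      (any≡does-any? (λ a → any? (λ b → comb (a , b) ≈? v) elements) elements)
      where
      any-cong : ∀ {f g : Carrier → Bool} → (∀ x → f x ≡ g x) → ∀ xs → any f xs ≡ any g xs
      any-cong f≗g xs = cong (foldr _∨_ false) (map-cong f≗g xs)

    module _ (indep : LinIndep (pair u w)) where

      comb-injective : ∀ {p p′} → comb p ≈ comb p′ → p ≡ p′
      comb-injective {a , b} {a′ , b′} eq = cong₂ _,_ (x-y≡0⇒x≡y (vanish Fin.zero)) (x-y≡0⇒x≡y (vanish (Fin.suc Fin.zero)))
        where
        c : Fin 2 → Carrier
        c = (a - a′) ∷ᶠ ((b - b′) ∷ᶠ []ᶠ)

        vanish : ∀ j → c j ≡ 0#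
        vanish = indep c λ i → begin
          (a - a′) * u i + ((b - b′) * w i + 0#)
            ≡⟨ cong ((a - a′) * u i +_) (+-identityʳ _) ⟩
          (a - a′) * u i + (b - b′) * w i
            ≡⟨ solve 6 (λ a a′ b b′ x y → (a :+ :- a′) :* x :+ (b :+ :- b′) :* y
                 := (a :* x :+ b :* y) :+ :- (a′ :* x :+ b′ :* y)) refl a a′ b b′ (u i) (w i) ⟩
          comb (a , b) i - comb (a′ , b′) i
            ≡⟨ cong (_- comb (a′ , b′) i) (eq i) ⟩
          comb (a′ , b′) i - comb (a′ , b′) i
            ≡⟨ -‿inverseʳ _ ⟩
          0# ∎

      -- By independence a vector of the line comes from exactly one coefficient pair, so counting
      -- pairs gives the indicator of membership.
      𝟙-inSpan2ᵇ : ∀ v → 𝟙 (inSpan2ᵇ u w v) ≡ Sum pairs (λ p → 𝟙 (does (comb p ≈? v)))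
      𝟙-inSpan2ᵇ v = by-cases (P.search (λ p → comb p ≈? v))
        where
        by-cases : Dec (∃ λ p → comb p ≈ v) → 𝟙 (inSpan2ᵇ u w v) ≡ Sum pairs (λ p → 𝟙 (does (comb p ≈? v)))
        by-cases (yes (p₀@(a , b) , p₀≈v)) = begin
          𝟙 (inSpan2ᵇ u w v)
            ≡⟨ cong 𝟙 (trans (inSpan2ᵇ≡does v) (dec-true (inSpan2? v) (lose (complete a) (lose (complete b) p₀≈v)))) ⟩
          1
            ≡⟨ P.Sum-δ₁ p₀ ⟨
          Sum pairs (λ p → 𝟙 (does (p ≟² p₀)))
            ≡⟨ Sum-cong pairs (λ p → cong 𝟙 (does-⇔
                 (mk⇔ (λ p≡p₀ i → trans (cong (λ p → comb p i) p≡p₀) (p₀≈v i))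
                      (λ p≈v → comb-injective (λ i → trans (p≈v i) (sym (p₀≈v i)))))
                 (p ≟² p₀) (comb p ≈? v))) ⟩
          Sum pairs (λ p → 𝟙 (does (comb p ≈? v))) ∎
        by-cases (no none) = begin
          𝟙 (inSpan2ᵇ u w v)
            ≡⟨ cong 𝟙 (trans (inSpan2ᵇ≡does v) (dec-false (inSpan2? v) (λ q →
                 let a , _ , r = find q ; b , _ , eq = find r in none ((a , b) , eq)))) ⟩
          0
            ≡⟨ Sum-zero pairs ⟨
          Sum pairs (λ _ → 0)
            ≡⟨ Sum-cong pairs (λ p → cong 𝟙 (sym (dec-false (comb p ≈? v) (λ eq → none (p , eq))))) ⟩
          Sum pairs (λ p → 𝟙 (does (comb p ≈? v))) ∎

      -- After the two summations are exchanged, each pair selects exactly one vector of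
      -- `allVecs n`, namely its combination.
      lineSum-pairs : ∀ {K} → Extensional K →
        lineSum K u w ≡ Sum pairs (λ p → 𝟙 (normalized (comb p)) ℕ.* K (comb p))
      lineSum-pairs {K} K-ext = begin
        lineSum K u w
          ≡⟨ Sum-filterᵇ _ (allVecs n) K ⟩
        Sum (allVecs n) (λ v → 𝟙 (normalized v ∧ inSpan2ᵇ u w v) ℕ.* K v)
          ≡⟨ Sum-cong (allVecs n) (λ v → trans
               (trans (cong (ℕ._* K v) (trans (𝟙-∧ (normalized v) _) (trans (ℕ.*-comm (𝟙 (normalized v)) _)
                 (cong (ℕ._* 𝟙 (normalized v)) (𝟙-inSpan2ᵇ v)))))
               (ℕ.*-assoc (Sum pairs (λ p → 𝟙 (does (comb p ≈? v)))) _ _))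
               (sym (Sum-*ʳ pairs (λ p → 𝟙 (does (comb p ≈? v))) _))) ⟩
        Sum (allVecs n) (λ v → Sum pairs (λ p → 𝟙 (does (comb p ≈? v)) ℕ.* (𝟙 (normalized v) ℕ.* K v)))
          ≡⟨ Sum-swap (allVecs n) pairs _ ⟩
        Sum pairs (λ p → Sum (allVecs n) (λ v → 𝟙 (does (comb p ≈? v)) ℕ.* (𝟙 (normalized v) ℕ.* K v)))
          ≡⟨ Sum-cong pairs (λ p → Sum-allVecs-δ n (comb p) {λ v → 𝟙 (normalized v) ℕ.* K v}
               (λ x≈y → cong₂ ℕ._*_ (cong 𝟙 (normalized-cong x≈y)) (K-ext x≈y))) ⟩
        Sum pairs (λ p → 𝟙 (normalized (comb p)) ℕ.* K (comb p)) ∎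

  infixl 7 _•²_
  _•²_ : Carrier → Carrier × Carrier → Carrier × Carrier
  c •² (a , b) = c * a , c * b

  𝟎² : Carrier × Carrier
  𝟎² = 0# , 0#

  •²-injective : ∀ {c} → c ≢ 0# → ∀ {p p′} → c •² p ≡ c •² p′ → p ≡ p′
  •²-injective c≢0 eq = cong₂ _,_ (*-cancelˡ c≢0 (cong proj₁ eq)) (*-cancelˡ c≢0 (cong proj₂ eq))

  -- Every nonzero pair has q - 1 nonzero multiples, one of which satisfies ν; the sum over ν is
  -- added to both sides to avoid the subtraction.
  Sum-homogeneous : ∀ (ν : Carrier × Carrier → Bool) (g : Carrier × Carrier → ℕ) → ν 𝟎² ≡ false →
    (∀ p → p ≢ 𝟎² → ∃ λ c₀ → ∀ c → ν (c •² p) ≡ does (c ≟ c₀)) →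
    (∀ {c} p → c ≢ 0# → g (c •² p) ≡ g p) →
    Sum pairs g ℕ.+ Sum pairs (λ p → 𝟙 (ν p) ℕ.* g p)
    ≡ g 𝟎² ℕ.+ q ℕ.* Sum pairs (λ p → 𝟙 (ν p) ℕ.* g p)
  Sum-homogeneous ν g ν-𝟎 ν-unique g-hom = begin
    Sum pairs g ℕ.+ X        ≡⟨ cong (ℕ._+ X) T+g𝟎 ⟨
    (T ℕ.+ g 𝟎²) ℕ.+ X       ≡⟨ cong (ℕ._+ X) (ℕ.+-comm T (g 𝟎²)) ⟩
    (g 𝟎² ℕ.+ T) ℕ.+ X       ≡⟨ ℕ.+-assoc (g 𝟎²) T X ⟩
    g 𝟎² ℕ.+ (T ℕ.+ X)       ≡⟨ cong (g 𝟎² ℕ.+_) T+X ⟩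
    g 𝟎² ℕ.+ q ℕ.* X         ∎
    where
    X T : ℕ
    X = Sum pairs (λ p → 𝟙 (ν p) ℕ.* g p)
    -- `T` is evaluated in two ways. For fixed c ≠ 0, scaling permutes the pairs and the row sums to
    -- `X`, while the row c = 0 vanishes. For fixed p ≠ `𝟎²`, one c survives and contributes g p,
    -- while the column of `𝟎²` vanishes.
    T = Sum elements (λ c → Sum pairs (λ p → 𝟙 (ν (c •² p)) ℕ.* g p))

    0•² : ∀ p → 0# •² p ≡ 𝟎²
    0•² (a , b) = cong₂ _,_ (zeroˡ a) (zeroˡ b)

    row : ∀ c → Dec (c ≡ 0#) → Sum pairs (λ p → 𝟙 (ν (c •² p)) ℕ.* g p) ℕ.+ 𝟙 (does (c ≟ 0#)) ℕ.* X ≡ X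
    row c (yes refl) = trans
      (cong₂ ℕ._+_
        (trans (Sum-cong pairs (λ p → cong (λ b → 𝟙 b ℕ.* g p) (trans (cong ν (0•² p)) ν-𝟎))) (Sum-zero pairs))
        (cong (λ b → 𝟙 b ℕ.* X) (dec-true (0# ≟ 0#) refl)))
      (ℕ.*-identityˡ X)
    row c (no c≢0) = trans
      (cong₂ ℕ._+_
        (trans (Sum-cong pairs (λ p → cong (𝟙 (ν (c •² p)) ℕ.*_) (sym (g-hom p c≢0))))
               (P.Sum-reindex (•²-injective c≢0) (λ p → 𝟙 (ν p) ℕ.* g p)))
        (cong (λ b → 𝟙 b ℕ.* X) (dec-false (c ≟ 0#) c≢0)))
      (ℕ.+-identityʳ X)

    T+X : T ℕ.+ X ≡ q ℕ.* X
    T+X = begin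
      T ℕ.+ X
        ≡⟨ cong (T ℕ.+_) (Sum-δ 0# (λ _ → X)) ⟨
      T ℕ.+ Sum elements (λ c → 𝟙 (does (c ≟ 0#)) ℕ.* X)
        ≡⟨ Sum-+ elements _ _ ⟨
      Sum elements (λ c → Sum pairs (λ p → 𝟙 (ν (c •² p)) ℕ.* g p) ℕ.+ 𝟙 (does (c ≟ 0#)) ℕ.* X)
        ≡⟨ Sum-cong elements (λ c → row c (c ≟ 0#)) ⟩
      Sum elements (λ _ → X)
        ≡⟨ Sum-const elements X ⟩
      q ℕ.* X ∎

    column : ∀ p → Dec (p ≡ 𝟎²) → Sum elements (λ c → 𝟙 (ν (c •² p)) ℕ.* g p) ℕ.+ 𝟙 (does (p ≟² 𝟎²)) ℕ.* g p ≡ g p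
    column p (yes refl) = trans
      (cong₂ ℕ._+_
        (trans (Sum-cong elements (λ c → cong (λ b → 𝟙 b ℕ.* g 𝟎²)
                 (trans (cong ν (cong₂ _,_ (zeroʳ c) (zeroʳ c))) ν-𝟎))) (Sum-zero elements))
        (cong (λ b → 𝟙 b ℕ.* g 𝟎²) (dec-true (𝟎² ≟² 𝟎²) refl)))
      (ℕ.*-identityˡ (g 𝟎²))
    column p (no p≢𝟎) = let c₀ , ν-c₀ = ν-unique p p≢𝟎 in trans
      (cong₂ ℕ._+_
        (trans (Sum-cong elements (λ c → cong (λ b → 𝟙 b ℕ.* g p) (ν-c₀ c))) (Sum-δ c₀ (λ _ → g p)))
        (cong (λ b → 𝟙 b ℕ.* g p) (dec-false (p ≟² 𝟎²) p≢𝟎)))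
      (ℕ.+-identityʳ (g p))

    T+g𝟎 : T ℕ.+ g 𝟎² ≡ Sum pairs g
    T+g𝟎 = begin
      T ℕ.+ g 𝟎²
        ≡⟨ cong₂ ℕ._+_ (Sum-swap elements pairs _) (sym (P.Sum-δ 𝟎² g)) ⟩
      Sum pairs (λ p → Sum elements (λ c → 𝟙 (ν (c •² p)) ℕ.* g p)) ℕ.+ Sum pairs (λ p → 𝟙 (does (p ≟² 𝟎²)) ℕ.* g p)
        ≡⟨ Sum-+ pairs _ _ ⟨
      Sum pairs (λ p → Sum elements (λ c → 𝟙 (ν (c •² p)) ℕ.* g p) ℕ.+ 𝟙 (does (p ≟² 𝟎²)) ℕ.* g p)
        ≡⟨ Sum-cong pairs (λ p → column p (p ≟² 𝟎²)) ⟩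
      Sum pairs g ∎

-- The congruence for line sums.

module ModArc (𝔽 : FiniteField) (m : ℕ) (odd : FiniteField.size 𝔽 ≡ suc (m ℕ.+ m))
              (α β : ℕ) (α+β≡1 : α ℕ.+ β ≡ 1) where
  open FieldTheory 𝔽
  open Vectors 𝔽
  open Geometry 𝔽
  open LineSums 𝔽
  open QuadraticCharacter 𝔽 m odd α β α+β≡1
  open BinaryForms 𝔽 m odd α β α+β≡1
  open Pairs 𝔽 using (pairs)
  open ≡-Reasoning

  -- Over the integers the equation reads X - h = q X - S, and q divides both terms on the right.
  mod-from-sum : ∀ {S X h} → q ∣ S → S ℕ.+ X ≡ h ℕ.+ q ℕ.* X → X ≡ h [mod q ]
  mod-from-sum {S} {X} {h} q∣S S+X≡h+qX = Signed.∣⇒∣ᵤ (subst (ℤ.+ q Signed.∣_) eq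
    (Signed.∣m∣n⇒∣m-n (Signed.∣ᵤ⇒∣ {ℤ.+ q} {ℤ.+ (q ℕ.* X)} (m∣m*n X)) (Signed.∣ᵤ⇒∣ {ℤ.+ q} {ℤ.+ S} q∣S)))
    where
    regroup : ∀ (s x h y : ℤ.ℤ) → s ℤ.+ x ≡ h ℤ.+ y → y ℤ.- s ≡ x ℤ.- h
    regroup s x h y s+x≡h+y = trans (cancel₁ s x h y) (trans (cong (ℤ._- (s ℤ.+ h)) (sym s+x≡h+y)) (cancel₂ s x h))
      where
      cancel₁ : ∀ s x h y → y ℤ.- s ≡ (h ℤ.+ y) ℤ.- (s ℤ.+ h)
      cancel₁ = ℤSolver.solve-∀
      cancel₂ : ∀ s x h → (s ℤ.+ x) ℤ.- (s ℤ.+ h) ≡ x ℤ.- h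
      cancel₂ = ℤSolver.solve-∀
    eq : ℤ.+ (q ℕ.* X) ℤ.- ℤ.+ S ≡ ℤ.+ X ℤ.- ℤ.+ h
    eq = regroup (ℤ.+ S) (ℤ.+ X) (ℤ.+ h) (ℤ.+ (q ℕ.* X)) (cong ℤ.+_ S+X≡h+qX)

  module _ {n} (F : QuadForm n) where

    κF-cong : Extensional (κ ∘ evalQ F)
    κF-cong x≈y = cong κ (evalQ-cong F x≈y)

    κF-• : ∀ {c} v → c ≢ 0# → κ (evalQ F (c • v)) ≡ κ (evalQ F v)
    κF-• {c} v c≢0 = trans (cong κ (evalQ-• F c v)) (κ-scale (evalQ F v) c≢0)

    evalQ-comb : ∀ u w p → evalQ F (comb u w p)
                 ≡ form (evalQ F u) (bilinear F u w + bilinear F w u) (evalQ F w) p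
    evalQ-comb u w (s , t) = begin
      evalQ F (s • u ⊕ t • w)
        ≡⟨ evalQ-⊕ F (s • u) (t • w) ⟩
      evalQ F (s • u) + (bilinear F (s • u) (t • w) + bilinear F (t • w) (s • u)) + evalQ F (t • w)
        ≡⟨ cong₂ _+_ (cong₂ _+_ (evalQ-• F s u) (cong₂ _+_
             (trans (bilinear-•ˡ F s u (t • w)) (cong (s *_) (bilinear-•ʳ F t u w)))
             (trans (bilinear-•ˡ F t w (s • u)) (cong (t *_) (bilinear-•ʳ F s w u))))) (evalQ-• F t w) ⟩
      s * s * evalQ F u + (s * (t * bilinear F u w) + t * (s * bilinear F w u)) + t * t * evalQ F w
        ≡⟨ solve 6 (λ s t a b c d → s :* s :* a :+ (s :* (t :* b) :+ t :* (s :* c)) :+ t :* t :* d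
             := a :* (s :* s) :+ (b :+ c) :* (s :* t) :+ d :* (t :* t)) refl s t _ _ _ _ ⟩
      form (evalQ F u) (bilinear F u w + bilinear F w u) (evalQ F w) (s , t) ∎

    -- `Sum-homogeneous` relates the total over pairs, which q divides, to the line sum. The residue
    -- is its term `g 𝟎²`, the value `κ 0#`.
    κF-line : ∀ u w → LinIndep (pair u w) → lineSum (κ ∘ evalQ F) u w ≡ half [mod q ]
    κF-line u w indep = mod-from-sum
      (subst (q ∣_) (sym (total-cong (evalQ-comb u w)))
        (q∣total-form (evalQ F u) (bilinear F u w + bilinear F w u) (evalQ F w)))
      (subst (λ X → Sum pairs g ℕ.+ X ≡ half ℕ.+ q ℕ.* X) (sym (lineSum-pairs u w indep κF-cong))
        (trans (Sum-homogeneous (normalized ∘ comb u w) g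
                 (trans (normalized-cong {u = comb u w 𝟎²} {𝟎} comb-𝟎) (normalized-𝟎 n)) ν-unique
                 (λ {c} p c≢0 → trans (κF-cong (comb-• c p)) (κF-• (comb u w p) c≢0)))
               (cong (ℕ._+ q ℕ.* Sum pairs (λ p → 𝟙 (normalized (comb u w p)) ℕ.* g p)) g-𝟎)))
      where
      g : Carrier × Carrier → ℕ
      g p = κ (evalQ F (comb u w p))

      comb-𝟎 : comb u w 𝟎² ≈ 𝟎
      comb-𝟎 i = trans (cong₂ _+_ (zeroˡ (u i)) (zeroˡ (w i))) (+-identityʳ 0#)

      comb-• : ∀ c p → comb u w (c •² p) ≈ (c • comb u w p)
      comb-• c (a , b) i = solve 5 (λ c a b x y → c :* a :* x :+ c :* b :* y := c :* (a :* x :+ b :* y)) refl c a b (u i) (w i)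

      g-𝟎 : g 𝟎² ≡ half
      g-𝟎 = trans (cong κ (trans (evalQ-cong F {comb u w 𝟎²} {𝟎} comb-𝟎) (evalQ-𝟎 F))) κ-zero

      ν-unique : ∀ p → p ≢ 𝟎² → ∃ λ c₀ → ∀ c → normalized (comb u w (c •² p)) ≡ does (c ≟ c₀)
      ν-unique p p≢𝟎 =
        let c₀ , _ , eq = normalizer (comb u w p)
                            (λ p≈𝟎 → p≢𝟎 (comb-injective u w indep (λ i → trans (p≈𝟎 i) (sym (comb-𝟎 i)))))
        in c₀ , λ c → trans (normalized-cong (comb-• c p)) (eq c)

-- Spans, independence and direct sums.

module LinearAlgebra (𝔽 : FiniteField) where
  open FieldTheory 𝔽
  open Vectors 𝔽
  open Geometry 𝔽
  open ≡-Reasoning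

  -- Coordinate vectors are encoded a second time as `Vec`, where `≡` is decidable and `Finite`
  -- applies.
  allVec : ∀ n → List (Vec Carrier n)
  allVec zero    = [] ∷ []
  allVec (suc n) = cartesianProductWith _∷_ elements (allVec n)

  allVec-complete : ∀ {n} (x : Vec Carrier n) → x ∈ allVec n
  allVec-complete []       = here refl
  allVec-complete (x ∷ xs) = ∈-cartesianProductWith⁺ _∷_ (complete x) (allVec-complete xs)

  allVec-unique : ∀ n → Unique (allVec n)
  allVec-unique zero    = [] ∷ []
  allVec-unique (suc n) = cartesianProductWith⁺ _∷_ Vec.∷-injective unique (allVec-unique n)

  lincomb-+ : ∀ {n k} (c d : Fin k → Carrier) (vs : Fin k → V n) →
              lincomb (λ j → c j + d j) vs ≈ (lincomb c vs ⊕ lincomb d vs)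
  lincomb-+ {k = k} c d vs i = trans
    (∑-cong (λ j → solve 3 (λ c d v → (c :+ d) :* v := c :* v :+ d :* v) refl (c j) (d j) (vs j i)))
    (∑-+ {k} (λ j → c j * vs j i) (λ j → d j * vs j i))

  lincomb-* : ∀ {n k} a (c : Fin k → Carrier) (vs : Fin k → V n) →
              lincomb (λ j → a * c j) vs ≈ (a • lincomb c vs)
  lincomb-* {k = k} a c vs i = trans (∑-cong (λ j → *-assoc a (c j) (vs j i))) (∑-* {k} a (λ j → c j * vs j i))

  InSpan-cong : ∀ {n k} (vs : Fin k → V n) {u w} → u ≈ w → InSpan vs u → InSpan vs w
  InSpan-cong vs u≈w (c , eq) = c , λ i → trans (eq i) (u≈w i)

  InSpan-⊕ : ∀ {n k} (vs : Fin k → V n) {u w} → InSpan vs u → InSpan vs w → InSpan vs (u ⊕ w)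
  InSpan-⊕ vs (c , c≈u) (d , d≈w) =
    (λ j → c j + d j) , λ i → trans (lincomb-+ c d vs i) (cong₂ _+_ (c≈u i) (d≈w i))

  InSpan-• : ∀ {n k} (vs : Fin k → V n) {u} a → InSpan vs u → InSpan vs (a • u)
  InSpan-• vs a (c , c≈u) = (λ j → a * c j) , λ i → trans (lincomb-* a c vs i) (cong (a *_) (c≈u i))

  InSpan-∷ : ∀ {n k} (vs : Fin k → V n) {u w} a → InSpan vs w → InSpan (u ∷ᶠ vs) (a • u ⊕ w)
  InSpan-∷ vs {u} a (c , c≈w) = (a ∷ᶠ c) , λ i → cong (a * u i +_) (c≈w i)

  unit : ∀ {k} → Fin k → Fin k → Carrier
  unit Fin.zero    Fin.zero    = 1#
  unit Fin.zero    (Fin.suc j) = 0#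
  unit (Fin.suc i) Fin.zero    = 0#
  unit (Fin.suc i) (Fin.suc j) = unit i j

  unit-diagonal : ∀ {k} (i : Fin k) → unit i i ≡ 1#
  unit-diagonal Fin.zero    = refl
  unit-diagonal (Fin.suc i) = unit-diagonal i

  ∑-0* : ∀ {k} (f : Fin k → Carrier) → ∑ (λ j → 0# * f j) ≡ 0#
  ∑-0* {k} f = trans (∑-* {k} 0# f) (zeroˡ (∑ f))

  lincomb-unit : ∀ {n k} (j : Fin k) (vs : Fin k → V n) → lincomb (unit j) vs ≈ vs j
  lincomb-unit Fin.zero    vs i =
    trans (cong₂ _+_ (*-identityˡ (vs Fin.zero i)) (∑-0* (λ j → vs (Fin.suc j) i))) (+-identityʳ _)
  lincomb-unit (Fin.suc j) vs i =
    trans (cong₂ _+_ (zeroˡ (vs Fin.zero i)) (lincomb-unit j (vs ∘ Fin.suc) i)) (+-identityˡ _)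

  InSpan-member : ∀ {n k} (vs : Fin k → V n) j → InSpan vs (vs j)
  InSpan-member vs j = unit j , lincomb-unit j vs

  LinIndep⇒≉𝟎 : ∀ {n k} (vs : Fin k → V n) → LinIndep vs → ∀ j → ¬ (vs j ≈ 𝟎)
  LinIndep⇒≉𝟎 vs indep j vs-j≈𝟎 = 0≢1 (trans
    (sym (indep (unit j) (λ i → trans (lincomb-unit j vs i) (vs-j≈𝟎 i)) j)) (unit-diagonal j))

  -- By finiteness, the injective map c ↦ Σ cⱼ vⱼ of 𝔽ⁿ into itself is surjective.
  LinIndep⇒spanning : ∀ {m n} → m ≡ n → (vs : Fin m → V n) → LinIndep vs → ∀ y → InSpan vs y
  LinIndep⇒spanning {n = n} refl vs indep y =
    let c , fc≡y = Vecs.injective⇒surjective f-injective (Vec.tabulate y)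
    in Vec.lookup c , λ i → begin
      lincomb (Vec.lookup c) vs i  ≡⟨ Vec.lookup∘tabulate (lincomb (Vec.lookup c) vs) i ⟨
      Vec.lookup (f c) i           ≡⟨ cong (λ z → Vec.lookup z i) fc≡y ⟩
      Vec.lookup (Vec.tabulate y) i ≡⟨ Vec.lookup∘tabulate y i ⟩
      y i                          ∎
    where
    module Vecs = Finite (Vec.≡-dec _≟_) (allVec n) allVec-complete (allVec-unique n)

    f : Vec Carrier n → Vec Carrier n
    f c = Vec.tabulate (lincomb (Vec.lookup c) vs)

    f-injective : Injective _≡_ _≡_ f
    f-injective {c} {d} fc≡fd = begin
      c                           ≡⟨ Vec.tabulate∘lookup c ⟨
      Vec.tabulate (Vec.lookup c) ≡⟨ Vec.tabulate-cong (λ j → x-y≡0⇒x≡y (trans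
                                       (solve 2 (λ x y → x :+ :- y := x :+ (:- :1) :* y) refl (Vec.lookup c j) (Vec.lookup d j))
                                       (indep difference difference≈𝟎 j))) ⟩
      Vec.tabulate (Vec.lookup d) ≡⟨ Vec.tabulate∘lookup d ⟩
      d                           ∎
      where
      -- Multiplication by `- 1#` in place of subtraction makes `lincomb-+` and `lincomb-*`
      -- applicable.
      difference : Fin n → Carrier
      difference j = Vec.lookup c j + (- 1#) * Vec.lookup d j

      same : ∀ i → lincomb (Vec.lookup c) vs i ≡ lincomb (Vec.lookup d) vs i
      same i = trans (sym (Vec.lookup∘tabulate _ i))
        (trans (cong (λ z → Vec.lookup z i) fc≡fd) (Vec.lookup∘tabulate _ i))

      difference≈𝟎 : lincomb difference vs ≈ 𝟎
      difference≈𝟎 i = begin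
        lincomb difference vs i
          ≡⟨ lincomb-+ (Vec.lookup c) (λ j → (- 1#) * Vec.lookup d j) vs i ⟩
        lincomb (Vec.lookup c) vs i + lincomb (λ j → (- 1#) * Vec.lookup d j) vs i
          ≡⟨ cong₂ _+_ (same i) (lincomb-* (- 1#) (Vec.lookup d) vs i) ⟩
        lincomb (Vec.lookup d) vs i + (- 1#) * lincomb (Vec.lookup d) vs i
          ≡⟨ solve 1 (λ x → x :+ (:- :1) :* x := (:1 :+ :- :1) :* x) refl (lincomb (Vec.lookup d) vs i) ⟩
        (1# - 1#) * lincomb (Vec.lookup d) vs i
          ≡⟨ trans (cong (_* lincomb (Vec.lookup d) vs i) (-‿inverseʳ 1#)) (zeroˡ _) ⟩
        0# ∎

  ∑-split : ∀ k l (f : Fin (k ℕ.+ l) → Carrier) → ∑ f ≡ ∑ (λ j → f (j ↑ˡ l)) + ∑ (λ j → f (k ↑ʳ j))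
  ∑-split zero    l f = sym (+-identityˡ (∑ f))
  ∑-split (suc k) l f =
    trans (cong (f Fin.zero +_) (∑-split k l (f ∘ Fin.suc))) (sym (+-assoc _ _ _))

  lincomb-++ : ∀ {n k l} (c : Fin (k ℕ.+ l) → Carrier) (us : Fin k → V n) (vs : Fin l → V n) →
               lincomb c (us ++ᶠ vs) ≈ (lincomb (λ j → c (j ↑ˡ l)) us ⊕ lincomb (λ j → c (k ↑ʳ j)) vs)
  lincomb-++ {k = k} {l} c us vs i = trans (∑-split k l (λ j → c j * (us ++ᶠ vs) j i))
    (cong₂ _+_ (∑-cong (λ j → cong (λ v → c (j ↑ˡ l) * v i) (lookup-++ˡ us vs j)))
               (∑-cong (λ j → cong (λ v → c (k ↑ʳ j) * v i) (lookup-++ʳ us vs j))))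

  -- A vanishing combination splits as x + y = 0 with x in the first span and y in the second; then
  -- x = - y lies in both, so each part vanishes separately.
  LinIndep-++ : ∀ {n k l} (us : Fin k → V n) (vs : Fin l → V n) → LinIndep us → LinIndep vs →
                (∀ v → InSpan us v → InSpan vs v → v ≈ 𝟎) → LinIndep (us ++ᶠ vs)
  LinIndep-++ {n} {k} {l} us vs us-indep vs-indep disjoint c c≈𝟎 j =
    trans (cong c (sym (join-splitAt k l j))) (vanish (splitAt k j))
    where
    x y : V n
    x = lincomb (λ j → c (j ↑ˡ l)) us
    y = lincomb (λ j → c (k ↑ʳ j)) vs

    x+y≈𝟎 : (x ⊕ y) ≈ 𝟎
    x+y≈𝟎 i = trans (sym (lincomb-++ c us vs i)) (c≈𝟎 i)

    x≈-y : ((- 1#) • y) ≈ x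
    x≈-y i = begin
      (- 1#) * y i                 ≡⟨ solve 2 (λ x y → (:- :1) :* y := x :+ :- (x :+ y)) refl (x i) (y i) ⟩
      x i - (x i + y i)            ≡⟨ cong (λ z → x i - z) (x+y≈𝟎 i) ⟩
      x i - 0#                     ≡⟨ trans (cong (x i +_) -0#≈0#) (+-identityʳ (x i)) ⟩
      x i                          ∎

    x≈𝟎 : x ≈ 𝟎
    x≈𝟎 = disjoint x (_ , λ _ → refl) (InSpan-cong vs x≈-y (InSpan-• vs (- 1#) (_ , λ _ → refl)))

    y≈𝟎 : y ≈ 𝟎
    y≈𝟎 i = trans (sym (trans (cong (_+ y i) (x≈𝟎 i)) (+-identityˡ (y i)))) (x+y≈𝟎 i)

    vanish : ∀ s → c (Fin.join k l s) ≡ 0#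
    vanish (inj₁ j) = us-indep _ x≈𝟎 j
    vanish (inj₂ j) = vs-indep _ y≈𝟎 j

  direct-sum : ∀ {n k l} (us : Fin k → V n) (vs : Fin l → V n) → k ℕ.+ l ≡ n →
               LinIndep us → LinIndep vs → (∀ v → InSpan us v → InSpan vs v → v ≈ 𝟎) →
               ∀ y → ∃ λ σ → ∃ λ γ → InSpan us σ × InSpan vs γ × (σ ⊕ γ) ≈ y
  direct-sum us vs k+l≡n us-indep vs-indep disjoint y =
    let c , eq = LinIndep⇒spanning k+l≡n (us ++ᶠ vs) (LinIndep-++ us vs us-indep vs-indep disjoint) y
    in _ , _ , (_ , λ _ → refl) , (_ , λ _ → refl) , λ i → trans (sym (lincomb-++ c us vs i)) (eq i)

-- Arcs of non-degenerate quadrics are not lifted.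

module NotLifted (𝔽 : FiniteField) (m : ℕ) (odd : FiniteField.size 𝔽 ≡ suc (m ℕ.+ m))
                 (α β : ℕ) (α+β≡1 : α ℕ.+ β ≡ 1) where
  open FieldTheory 𝔽
  open Vectors 𝔽
  open Geometry 𝔽
  open LinearAlgebra 𝔽
  open QuadraticCharacter 𝔽 m odd α β α+β≡1
  open ModArc 𝔽 m odd α β α+β≡1
  open ≡-Reasoning

  q≢1 : q ≢ 1
  q≢1 q≡1 = 0≢1 (rank-injective (Fin1 q≡1 (rank 0#) (rank 1#)))
    where
    Fin1 : ∀ {n} → n ≡ 1 → (i j : Fin n) → i ≡ j
    Fin1 refl Fin.zero Fin.zero = refl

  half≰1 : ¬ (half ≤ 1)
  half≰1 half≤1 = q≢1 (ℕ.≤-antisym q≤1 1≤q)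
    where
    q≤1 : q ≤ 1
    q≤1 = ℕ.≤-pred (subst (_≤ 2) half+half≡1+q (ℕ.+-mono-≤ half≤1 half≤1))
    1≤q : 1 ≤ q
    1≤q = subst (1 ≤_) (sym odd) (s≤s z≤n)

  α≤1 : α ≤ 1
  α≤1 = subst (α ≤_) α+β≡1 (ℕ.m≤m+n α β)

  β≤1 : β ≤ 1
  β≤1 = subst (β ≤_) α+β≡1 (ℕ.m≤n+m β α)

  -- `α` and `β` are at most 1 and `half` is not. This places Γ on the quadric and also shows that
  -- `κ` is not constant.
  κ≡half⇒≡0 : ∀ {x} → κ x ≡ half → x ≡ 0#
  κ≡half⇒≡0 {x} κx≡half = by-cases (x ≟ 0#) (square? x)
    where
    by-cases : Dec (x ≡ 0#) → Dec (Square x) → x ≡ 0#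
    by-cases (yes x≡0) _        = x≡0
    by-cases (no x≢0)  (yes sq) =
      contradiction (subst (_≤ 1) (trans (sym (κ-square x≢0 sq)) κx≡half) α≤1) half≰1
    by-cases (no _)    (no ¬sq) =
      contradiction (subst (_≤ 1) (trans (sym (κ-nonsquare ¬sq)) κx≡half) β≤1) half≰1

  undo : ∀ r t p → (r + t * p) + (- t) * p ≡ r
  undo = solve 3 (λ r t p → (r :+ t :* p) :+ (:- t) :* p := r) refl

  unscale : ∀ {c} → c ≢ 0# → ∃ λ d → ∀ x → d * (c * x) ≡ x
  unscale {c} c≢0 =
    let d , cd≡1 = inverse c c≢0
    in d , λ x → trans (solve 3 (λ c d x → d :* (c :* x) := (c :* d) :* x) refl c d x)
                       (trans (cong (_* x) cd≡1) (*-identityˡ x))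

  module _ {r} (F : QuadForm (suc r)) (nondegenerate : NonDegenerate F) where

    module _ {k} (Γv : Fin k → V (suc r))
             (onΓ : ∀ P → IsPoint P → InSpan Γv P → κ (evalQ F P) ≡ half) where

      Γ-singular : ∀ v → InSpan Γv v → evalQ F v ≡ 0#
      Γ-singular v v∈Γ = by-cases (v ≈? 𝟎)
        where
        by-cases : Dec (v ≈ 𝟎) → evalQ F v ≡ 0#
        by-cases (yes v≈𝟎) = trans (evalQ-cong F v≈𝟎) (evalQ-𝟎 F)
        by-cases (no v≉𝟎)  =
          let c , c≢0 , eq = normalizer v v≉𝟎
              cv-point = trans (eq c) (dec-true (c ≟ c) refl)
          in κ≡half⇒≡0 (trans (sym (κF-• F v c≢0)) (onΓ (c • v) cv-point (InSpan-• Γv c v∈Γ)))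

      -- P, γ and their sum all lie in Γ, so the three values of the form that make up `polar`
      -- vanish.
      Γ-isotropic : ∀ {P γ} → InSpan Γv P → InSpan Γv γ → polar F P γ ≡ 0#
      Γ-isotropic {P} {γ} P∈Γ γ∈Γ = begin
        evalQ F (P ⊕ γ) + (- evalQ F P + - evalQ F γ)
          ≡⟨ cong₂ _+_ (Γ-singular (P ⊕ γ) (InSpan-⊕ Γv P∈Γ γ∈Γ))
               (cong₂ (λ a b → - a + - b) (Γ-singular P P∈Γ) (Γ-singular γ γ∈Γ)) ⟩
        0# + (- 0# + - 0#)
          ≡⟨ cong (λ z → 0# + (z + z)) -0#≈0# ⟩
        0# + (0# + 0#)
          ≡⟨ trans (+-identityˡ _) (+-identityˡ 0#) ⟩
        0# ∎

    not-lifted : ¬ IsLifted r half (κ ∘ evalQ F)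
    not-lifted (s , 1≤s , s<r , Σv , Σ-indep , Γv , Γ-indep , disjoint , K₀ , _ , onΓ , onLines) =
      P≉𝟎 (nondegenerate P (λ y → decidable-stable (polar F P y ≟ 0#) (polar≢0⇒⊥ y)))
      where
      -- Since s < r, the vertex Γ has at least one spanning vector.
      j₀ : Fin (r ∸ s)
      j₀ = Fin.fromℕ< {0} (ℕ.m<n⇒0<n∸m s<r)

      P : V (suc r)
      P = Γv j₀

      P∈Γ : InSpan Γv P
      P∈Γ = InSpan-member Γv j₀

      P≉𝟎 : ¬ (P ≈ 𝟎)
      P≉𝟎 = LinIndep⇒≉𝟎 Γv Γ-indep j₀

      QP≡0 : evalQ F P ≡ 0#
      QP≡0 = Γ-singular Γv onΓ P P∈Γ

      module _ {R} (R-point : IsPoint R) (R∈Σ : InSpan Σv R) where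

        R∉Γ : ¬ InSpan Γv R
        R∉Γ R∈Γ = point≉𝟎 R-point (disjoint R R∈Σ R∈Γ)

        R+tP∉Γ : ∀ t → ¬ InSpan Γv (R ⊕ t • P)
        R+tP∉Γ t R+tP∈Γ = R∉Γ (InSpan-cong Γv
          (λ i → undo (R i) t (P i))
          (InSpan-⊕ Γv R+tP∈Γ (InSpan-• Γv (- t) P∈Γ)))

        R+tP≉𝟎 : ∀ t → ¬ ((R ⊕ t • P) ≈ 𝟎)
        R+tP≉𝟎 t v≈𝟎 = R+tP∉Γ t
          (InSpan-cong Γv (λ i → trans (zeroˡ (P i)) (sym (v≈𝟎 i))) (InSpan-• Γv 0# P∈Γ))

        -- The definition of a lifted arc speaks of canonical representatives only, so v = R + t P
        -- is first rescaled by `c`. Then R = d (c v) - t P shows that R is the projection of this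
        -- point from Γ.
        κ-line : ∀ t → κ (evalQ F (R ⊕ t • P)) ≡ K₀ R
        κ-line t =
          let c , c≢0 , eq = normalizer (R ⊕ t • P) (R+tP≉𝟎 t)
              d , dc≡1 = unscale c≢0
          in at-point c≢0 (trans (eq c) (dec-true (c ≟ c) refl)) dc≡1
          where
          v : V (suc r)
          v = R ⊕ t • P

          at-point : ∀ {c d} → c ≢ 0# → IsPoint (c • v) → (∀ x → d * (c * x) ≡ x) → κ (evalQ F v) ≡ K₀ R
          at-point {c} {d} c≢0 cv-point dc≡1 =
            trans (sym (κF-• F v c≢0)) (onLines (c • v) cv-point cv∉Γ R R-point R∈Σ R∈⟨cv,Γ⟩)
            where
            cv∉Γ : ¬ InSpan Γv (c • v)
            cv∉Γ cv∈Γ = R+tP∉Γ t (InSpan-cong Γv (λ i → dc≡1 (v i)) (InSpan-• Γv d cv∈Γ))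

            R∈⟨cv,Γ⟩ : InSpan ((c • v) ∷ᶠ Γv) R
            R∈⟨cv,Γ⟩ = InSpan-cong ((c • v) ∷ᶠ Γv)
              (λ i → trans (cong (_+ (- t) * P i) (dc≡1 (v i)))
                (undo (R i) t (P i)))
              (InSpan-∷ Γv {c • v} d (InSpan-• Γv (- t) P∈Γ))

        Q-line : ∀ t → evalQ F (R ⊕ t • P) ≡ evalQ F R + t * polar F P R
        Q-line t = begin
          evalQ F (R ⊕ t • P)
            ≡⟨ evalQ-⊕-• F t R P ⟩
          evalQ F R + t * polar F P R + (t * t) * evalQ F P
            ≡⟨ cong (evalQ F R + t * polar F P R +_) (trans (cong ((t * t) *_) QP≡0) (zeroʳ (t * t))) ⟩
          evalQ F R + t * polar F P R + 0#
            ≡⟨ +-identityʳ _ ⟩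
          evalQ F R + t * polar F P R ∎

        polar≢0⇒κ-constant : polar F P R ≢ 0# → ∀ z → κ z ≡ K₀ R
        polar≢0⇒κ-constant π≢0 z =
          let i , πi≡1 = inverse (polar F P R) π≢0
              t = (z - evalQ F R) * i
          in trans (cong κ (sym (trans (Q-line t) (reach i πi≡1)))) (κ-line t)
          where
          reach : ∀ i → polar F P R * i ≡ 1# → evalQ F R + ((z - evalQ F R) * i) * polar F P R ≡ z
          reach i πi≡1 = begin
            evalQ F R + ((z - evalQ F R) * i) * polar F P R
              ≡⟨ solve 4 (λ e z i π → e :+ ((z :+ :- e) :* i) :* π := e :+ (z :+ :- e) :* (π :* i))
                   refl (evalQ F R) z i (polar F P R) ⟩
            evalQ F R + (z - evalQ F R) * (polar F P R * i)
              ≡⟨ cong (λ u → evalQ F R + (z - evalQ F R) * u) πi≡1 ⟩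
            evalQ F R + (z - evalQ F R) * 1#
              ≡⟨ solve 2 (λ e z → e :+ (z :+ :- e) :* :1 := z) refl (evalQ F R) z ⟩
            z ∎

        -- Otherwise `κ 1#` and `κ 0#` both equal `K₀ R`, so `κ 1#` is `half` and 1 = 0.
        polar≡0 : polar F P R ≡ 0#
        polar≡0 = decidable-stable (polar F P R ≟ 0#) (λ π≢0 → 0≢1 (sym (κ≡half⇒≡0
          (trans (polar≢0⇒κ-constant π≢0 1#) (trans (sym (polar≢0⇒κ-constant π≢0 0#)) κ-zero)))))

      Σ-isotropic : ∀ {σ} → InSpan Σv σ → polar F P σ ≡ 0#
      Σ-isotropic {σ} σ∈Σ = by-cases (σ ≈? 𝟎)
        where
        by-cases : Dec (σ ≈ 𝟎) → polar F P σ ≡ 0#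
        by-cases (yes σ≈𝟎) = begin
          polar F P σ
            ≡⟨ polar-bilinear F P σ ⟩
          bilinear F P σ + bilinear F σ P
            ≡⟨ cong₂ _+_ (bilinear-cong F {P} {P} {σ} {0# • 𝟎} (λ _ → refl) (λ i → trans (σ≈𝟎 i) (sym (zeroˡ 0#))))
                         (bilinear-cong F {σ} {0# • 𝟎} {P} {P} (λ i → trans (σ≈𝟎 i) (sym (zeroˡ 0#))) (λ _ → refl)) ⟩
          bilinear F P (0# • 𝟎) + bilinear F (0# • 𝟎) P
            ≡⟨ polar-bilinear F P (0# • 𝟎) ⟨
          polar F P (0# • 𝟎)
            ≡⟨ polar-•ʳ F 0# P 𝟎 ⟩
          0# * polar F P 𝟎
            ≡⟨ zeroˡ _ ⟩
          0# ∎
        by-cases (no σ≉𝟎) =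
          let c , c≢0 , eq = normalizer σ σ≉𝟎
              R-point = trans (eq c) (dec-true (c ≟ c) refl)
          in x*y≡0⇒y≡0 c≢0 (trans (sym (polar-•ʳ F c P σ)) (polar≡0 R-point (InSpan-• Σv c σ∈Σ)))

      polar≢0⇒⊥ : ∀ y → ¬ (polar F P y ≢ 0#)
      polar≢0⇒⊥ y polar≢0 =
        let σ , γ , σ∈Σ , γ∈Γ , σ+γ≈y = direct-sum Σv Γv dimension Σ-indep Γ-indep disjoint y
        in polar≢0 (trans (polar-cong σ+γ≈y) (trans (polar-⊕ʳ F P σ γ)
             (trans (cong₂ _+_ (Σ-isotropic σ∈Σ) (Γ-isotropic Γv onΓ P∈Γ γ∈Γ)) (+-identityˡ 0#))))
        where
        dimension : suc s ℕ.+ (r ∸ s) ≡ suc r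
        dimension = cong suc (ℕ.m+[n∸m]≡n (ℕ.<⇒≤ s<r))

        polar-cong : ∀ {x} → x ≈ y → polar F P y ≡ polar F P x
        polar-cong x≈y = cong₂ (λ a b → a + (- evalQ F P + - b))
          (evalQ-cong F (λ i → cong (P i +_) (sym (x≈y i)))) (evalQ-cong F (λ i → sym (x≈y i)))

-- Parity of the field order.

even⊎odd : ∀ n → 2 ∣ n ⊎ ∃ λ m → n ≡ suc (m ℕ.+ m)
even⊎odd zero    = inj₁ (divides 0 refl)
even⊎odd (suc n) = [ after-even , after-odd ]′ (even⊎odd n)
  where
  double : ∀ k → k ℕ.* 2 ≡ k ℕ.+ k
  double = solve-∀

  double-suc : ∀ k → suc (suc (k ℕ.+ k)) ≡ suc k ℕ.* 2
  double-suc = solve-∀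

  after-even : 2 ∣ n → 2 ∣ suc n ⊎ ∃ λ m → suc n ≡ suc (m ℕ.+ m)
  after-even (divides k n≡k*2) = inj₂ (k , cong suc (trans n≡k*2 (double k)))

  after-odd : (∃ λ m → n ≡ suc (m ℕ.+ m)) → 2 ∣ suc n ⊎ ∃ λ m → suc n ≡ suc (m ℕ.+ m)
  after-odd (m , n≡1+2m) = inj₁ (divides (suc m) (trans (cong suc n≡1+2m) (double-suc m)))

prime∣^⇒∣ : ∀ {p} → Prime p → ∀ n k → p ∣ n ^ suc k → p ∣ n
prime∣^⇒∣ p-prime n zero    p∣n¹   = subst (_ ∣_) (ℕ.*-identityʳ n) p∣n¹
prime∣^⇒∣ p-prime n (suc k) p∣nⁿ⁺¹ = [ id , prime∣^⇒∣ p-prime n k ]′ (euclidsLemma n (n ^ suc k) p-prime p∣nⁿ⁺¹)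

-- If 2 divided the power it would divide p itself, and irreducibility of p leaves 2 = 1 or 2 = p.
odd-prime-power : ∀ {p} → Prime p → p ≢ 2 → ∀ k → ∃ λ m → p ^ suc k ≡ suc (m ℕ.+ m)
odd-prime-power {p} p-prime p≢2 k = [ (λ 2∣pᵏ → contradiction (prime∣^⇒∣ prime[2] p k 2∣pᵏ) 2∤p) , id ]′ (even⊎odd (p ^ suc k))
  where
  2∤p : ¬ (2 ∣ p)
  2∤p 2∣p = [ (λ ()) , p≢2 ∘ sym ]′ (prime⇒irreducible p-prime 2∣p)

theorem5 : (𝔽 : FiniteField) → (p k : ℕ) → Prime p → p ≢ 2
    → FiniteField.size 𝔽 ≡ p ^ suc k
    → (r : ℕ) → 2 ≤ r → (F : Geometry.QuadForm 𝔽 (suc r))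
    → (Geometry.IsModArc 𝔽 r (Geometry.half 𝔽) (Geometry.K₁ 𝔽 F)
    × Geometry.IsModArc 𝔽 r (Geometry.half 𝔽) (Geometry.K₂ 𝔽 F))
    × (Geometry.NonDegenerate 𝔽 F
    → ¬ Geometry.IsLifted 𝔽 r (Geometry.half 𝔽) (Geometry.K₁ 𝔽 F)
    × ¬ Geometry.IsLifted 𝔽 r (Geometry.half 𝔽) (Geometry.K₂ 𝔽 F))
theorem5 𝔽 p k p-prime p≢2 size≡pᵏ r 2≤r F =
  -- The constants are the value on nonzero squares followed by the value on nonsquares: `0 1` for
  -- `K₁` and `1 0` for `K₂`.
  (ModArc.κF-line 𝔽 m odd 0 1 refl F , ModArc.κF-line 𝔽 m odd 1 0 refl F) ,
  λ nondegenerate → NotLifted.not-lifted 𝔽 m odd 0 1 refl F nondegenerate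
                  , NotLifted.not-lifted 𝔽 m odd 1 0 refl F nondegenerate
  where
  m : ℕ
  m = proj₁ (odd-prime-power p-prime p≢2 k)

  odd : FiniteField.size 𝔽 ≡ suc (m ℕ.+ m)
  odd = trans size≡pᵏ (proj₂ (odd-prime-power p-prime p≢2 k))
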